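{- Let $\ell$ be a prime and $t$ an integer. Then for every integer $k\ge3$, $$\frac{S(t;\ell^k)}{\ell^{5k-5}}=\begin{cases} \ell^2(\ell^2+1)(\ell-1)&\text{if }\ell\mid t\text{ and }\ell>2,\\ \frac{\ell^2(\ell^4-2\ell^2-3\ell-1)}{\ell+1}-\frac{\ell^4}{\ell^{2k}(\ell+1)}&\text{if }\ell\nmid 2t,\\ 4&\text{if }\ell=2\text{ and }2\nmid t,\\ \frac{35}{2}&\text{if }\ell=2\text{ and }4\mid t,\\ \frac{103}{6}-\frac{32}{3\cdot 2^{2k}}&\text{if }\ell=2,\ 2\mid t,\text{ and }4\nmid t. \end{cases}$$
   Context: For a prime $\ell$, an integer $k\ge1$ and $t,u\in\mathbb{Z}/\ell^k\mathbb{Z}$, let $m(t,u;\ell^k)$ be the number of $2\times2$ matrices $A$ with entries in $\mathbb{Z}/\ell^k\mathbb{Z}$ with $\operatorname{tr}(A)=t$ and $\det(A)=u$. For an integer $t$ set $S(t;\ell^k):=\sum_{u\in(\mathbb{Z}/\ell^k\mathbb{Z})^*}m(t,u;\ell^k)^2$. -}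

module Defs where

open import Data.Nat as ℕ using (ℕ; zero; suc)
open import Data.Nat.Divisibility using (_∣?_)
open import Data.Nat.GCD using (gcd)
open import Data.Integer as ℤ using (ℤ; +_; ∣_∣)
open import Data.Rational as ℚ using (ℚ; 0ℚ)
open import Data.List using (List; upTo; map; filter)
open import Data.Nat.ListAction using (sum)
open import Relation.Nullary.Decidable using (does)
open import Data.Bool using (if_then_else_; _∧_)
open import Data.Nat using (_≟_)

congMod : ℕ → ℤ → ℤ → Data.Bool.Bool
congMod N x y = does (N ∣? ∣ x ℤ.- y ∣)

-- Elements of ℤ/Nℤ are represented by 0,…,N-1.
-- m(t,u;N) = #{ A = (a b ; c d) over ℤ/Nℤ : tr A = t, det A = u }
m : ℤ → ℤ → ℕ → ℕ
m t u N =
  sum (map (λ a → sum (map (λ b → sum (map (λ c → sum (map (λ d →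
    if congMod N (+ a ℤ.+ + d) t ∧ congMod N (+ a ℤ.* + d ℤ.- + b ℤ.* + c) u
    then 1 else 0) (upTo N))) (upTo N))) (upTo N))) (upTo N))

units : ℕ → List ℕ
units N = filter (λ u → gcd u N ≟ 1) (upTo N)

S : ℤ → ℕ → ℕ
S t N = sum (map (λ u → m t (+ u) N ℕ.* m t (+ u) N) (units N))

-- rational n / d for a positive denominator d (d = 0 never used)
_/ℕ_ : ℤ → ℕ → ℚ
n /ℕ zero = 0ℚ
n /ℕ suc d = n ℚ./ suc d

{-# OPTIONS --safe #-}
-- S(t; ℓᵏ) counts the pairs (A, B) of matrices of trace t with det A ≡ det B a unit, that is,
-- points (A, B) in six variables on the quadric det A - det B ≡ 0 (mod ℓᵏ). Completing the
-- square replaces det by s² - a² - b c, where t ≡ 2 s (for ℓ = 2 and t odd no such s exists,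
-- but then every point is smooth). By Hensel's lemma the points that are smooth modulo ℓ number
-- ℓ⁵⁽ᵏ⁻¹⁾ times their number modulo ℓ. For odd ℓ the singular points are the multiples of ℓ,
-- and dividing by ℓ turns them into the points modulo ℓᵏ⁻², each occurring ℓ⁶ times; this gives a
-- linear recurrence of step 2 in k. For ℓ = 2 there is a second singular class, a and a′ odd and
-- b, c, b′, c′ even, in which a = 2 x + 1 leads to a smooth quadric modulo 2ᵏ⁻².
module Submission where

-- The unit condition on the determinant is carried as a weight of period ℓ. Such a weight is
-- constant on residue classes modulo ℓ, so it does not disturb the lifting of smooth points, and on
-- a singular class it becomes a single constant. That constant decides the shape of the answer. For
-- odd ℓ the singular class has determinant s² modulo ℓ: it drops out when ℓ divides t and
-- contributes otherwise. For ℓ = 2 and t = 2 s the singular classes with a even and a odd have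
-- determinants s² and s² - 1 modulo 2, so exactly one survives, according to the parity of s. The
-- terms in ℓ⁻²ᵏ come from the class of the origin alone: its recurrence multiplies by ℓ⁶ in two
-- steps, and the homogeneous solution ℓ³ᵏ accompanies the main term ℓ⁵ᵏ. The bound k ≥ 3 enters for
-- ℓ = 2 and t even, where the odd class leaves the modulus 2ᵏ⁻², which must be a positive power of
-- 2 for lifting to start. No quotient ring is formed: counts are integer sums over 0, ..., N - 1 of
-- products of indicators, so that case distinctions and complements become ring identities.

module Counting where
  open import Defs using (m; S; _/ℕ_)
  open import Data.Bool using (true; false; if_then_else_; _∧_)
  open import Data.Nat as ℕ using (ℕ; zero; suc; NonZero)
  import Data.Nat.Properties as ℕ
  import Data.Nat.Divisibility as ℕ
  import Data.Nat.Coprimality as ℕ using (Coprime; coprime-Bézout; coprime-divisor; coprime⇒gcd≡1)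
  open import Data.Nat.GCD using (gcd; gcd-greatest; module Bézout)
  open import Data.Nat.ListAction using (sum)
  open import Data.Nat.Primality using (Prime; prime[2]; prime⇒irreducible; prime⇒nonZero; prime⇒nonTrivial; euclidsLemma)
  open import Data.Integer hiding (suc; NonZero; _/ℕ_)
  open import Data.Integer.Properties
  open import Data.Integer.Divisibility.Signed
  open import Data.Integer.Tactic.RingSolver using (solve-∀)
  import Data.Rational as ℚ
  import Data.Rational.Properties as ℚ
  import Data.Rational.Unnormalised as ℚᵘ
  import Data.Rational.Unnormalised.Properties as ℚᵘ
  open import Data.List using ([]; _∷_; upTo; applyUpTo; filter) renaming (map to mapᴸ)
  open import Data.Vec using (Vec; []; _∷_; zipWith; map; replicate)
  open import Data.Vec.Relation.Unary.All using (All; []; _∷_)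
  open import Data.Vec.Relation.Unary.Any using (Any; here; there)
  open import Data.Product using (∃; ∃₂; _×_; _,_)
  open import Data.Sum using (_⊎_; inj₁; inj₂; [_,_]′)
  open import Function using (_∘_; id)
  open import Relation.Binary.PropositionalEquality
  open import Relation.Nullary using (¬_; Dec; yes; no; does; contradiction)
  open import Relation.Nullary.Decidable using (dec-true; dec-false)
  open import Relation.Unary using (Decidable)

  -- Sums over residues

  ∑ : ℕ → (ℤ → ℤ) → ℤ
  ∑ zero    f = 0ℤ
  ∑ (suc n) f = f 0ℤ + ∑ n (λ x → f (1ℤ + x))

  syntax ∑ n (λ x → e) = ∑[ x < n ] e
  infix 5 ∑

  ∑-cong-< : ∀ n {f g : ℤ → ℤ} → (∀ i → i ℕ.< n → f (+ i) ≡ g (+ i)) → ∑ n f ≡ ∑ n g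
  ∑-cong-< zero    h = refl
  ∑-cong-< (suc n) h = cong₂ _+_ (h 0 ℕ.z<s) (∑-cong-< n λ i i<n → h (suc i) (ℕ.s<s i<n))

  ∑-cong : ∀ n {f g : ℤ → ℤ} → (∀ x → f x ≡ g x) → ∑ n f ≡ ∑ n g
  ∑-cong n h = ∑-cong-< n λ i _ → h (+ i)

  ∑-*ˡ : ∀ n c f → (∑[ x < n ] c * f x) ≡ c * ∑ n f
  ∑-*ˡ zero    c f = sym (*-zeroʳ c)
  ∑-*ˡ (suc n) c f = trans (cong₂ _+_ (refl {x = c * f 0ℤ}) (∑-*ˡ n c g)) (sym (*-distribˡ-+ c (f 0ℤ) (∑ n g)))
    where
    g : ℤ → ℤ
    g x = f (1ℤ + x)

  ∑-*ʳ : ∀ n f c → (∑[ x < n ] f x * c) ≡ ∑ n f * c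
  ∑-*ʳ n f c = begin
    (∑[ x < n ] f x * c)  ≡⟨ ∑-cong n (λ x → *-comm (f x) c) ⟩
    (∑[ x < n ] c * f x)  ≡⟨ ∑-*ˡ n c f ⟩
    c * ∑ n f             ≡⟨ *-comm c _ ⟩
    ∑ n f * c             ∎
    where open ≡-Reasoning

  ∑-+ : ∀ n f g → (∑[ x < n ] f x + g x) ≡ ∑ n f + ∑ n g
  ∑-+ zero    f g = refl
  ∑-+ (suc n) f g = trans (cong₂ _+_ (refl {x = f 0ℤ + g 0ℤ}) (∑-+ n f⁺ g⁺)) (interchange (f 0ℤ) (g 0ℤ) (∑ n f⁺) (∑ n g⁺))
    where
    f⁺ g⁺ : ℤ → ℤ
    f⁺ x = f (1ℤ + x)
    g⁺ x = g (1ℤ + x)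
    interchange : ∀ a b c d → (a + b) + (c + d) ≡ (a + c) + (b + d)
    interchange = solve-∀

  ∑-neg : ∀ n f → (∑[ x < n ] - f x) ≡ - ∑ n f
  ∑-neg zero    f = refl
  ∑-neg (suc n) f = trans (cong₂ _+_ (refl {x = - f 0ℤ}) (∑-neg n f⁺)) (sym (neg-distrib-+ (f 0ℤ) (∑ n f⁺)))
    where
    f⁺ : ℤ → ℤ
    f⁺ x = f (1ℤ + x)

  ∑-− : ∀ n f g → (∑[ x < n ] f x - g x) ≡ ∑ n f - ∑ n g
  ∑-− n f g = trans (∑-+ n f (λ x → - g x)) (cong₂ _+_ (refl {x = ∑ n f}) (∑-neg n g))

  ∑-const : ∀ n c → (∑[ _ < n ] c) ≡ + n * c
  ∑-const zero    c = sym (*-zeroˡ c)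
  ∑-const (suc n) c = trans (cong₂ _+_ (refl {x = c}) (∑-const n c)) (sym (suc-* (+ n) c))

  ∑-0 : ∀ n → (∑[ _ < n ] 0ℤ) ≡ 0ℤ
  ∑-0 n = trans (∑-const n 0ℤ) (*-zeroʳ (+ n))

  ∑-swap : ∀ m n (f : ℤ → ℤ → ℤ) → (∑[ x < m ] ∑[ y < n ] f x y) ≡ (∑[ y < n ] ∑[ x < m ] f x y)
  ∑-swap zero    n f = sym (∑-0 n)
  ∑-swap (suc m) n f = trans (cong₂ _+_ (refl {x = ∑ n (f 0ℤ)}) (∑-swap m n (λ x → f (1ℤ + x))))
    (sym (∑-+ n (f 0ℤ) (λ y → ∑[ x < m ] f (1ℤ + x) y)))

  ∑-++ : ∀ m n f → ∑ (m ℕ.+ n) f ≡ ∑ m f + (∑[ x < n ] f (+ m + x))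
  ∑-++ zero    n f = trans (∑-cong n (λ x → cong f (sym (+-identityˡ x)))) (sym (+-identityˡ _))
  ∑-++ (suc m) n f = trans (cong₂ _+_ (refl {x = f 0ℤ}) (trans (∑-++ m n f⁺)
      (cong₂ _+_ (refl {x = ∑ m f⁺}) (∑-cong n λ x → cong f (sym (+-assoc 1ℤ (+ m) x))))))
    (sym (+-assoc (f 0ℤ) (∑ m f⁺) (∑[ x < n ] f (+ suc m + x))))
    where
    f⁺ : ℤ → ℤ
    f⁺ x = f (1ℤ + x)

  -- Division with remainder by `b`: `j` is the residue and `i` the lift. Every passage from one
  -- modulus to a larger one rests on this.
  ∑-digits : ∀ a b f → ∑ (a ℕ.* b) f ≡ (∑[ i < a ] ∑[ j < b ] f (j + + b * i))
  ∑-digits zero    b f = refl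
  ∑-digits (suc a) b f = trans (∑-++ b (a ℕ.* b) f) (cong₂ _+_
    (∑-cong b λ j → cong f (eq₀ j (+ b)))
    (trans (∑-digits a b _) (∑-cong a λ i → ∑-cong b λ j → cong f (eq₁ i j (+ b)))))
    where
    eq₀ : ∀ j b → j ≡ j + b * 0ℤ
    eq₀ = solve-∀
    eq₁ : ∀ i j b → b + (j + b * i) ≡ j + b * (1ℤ + i)
    eq₁ = solve-∀

  -- Periodic functions and the indicator of divisibility

  Periodic : ℕ → (ℤ → ℤ) → Set
  Periodic N f = ∀ x y → f (x + + N * y) ≡ f x

  ∑-shift-ℕ : ∀ N {f} → Periodic N f → ∀ n → (∑[ x < N ] f (+ n + x)) ≡ ∑ N f
  ∑-shift-ℕ N {f} per zero    = ∑-cong N λ x → cong f (+-identityˡ x)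
  ∑-shift-ℕ N {f} per (suc n) = begin
    (∑[ x < N ] f (+ suc n + x))        ≡⟨ ∑-cong N (λ x → cong f (eq₀ (+ n) x)) ⟩
    (∑[ x < N ] f (+ n + (1ℤ + x)))     ≡⟨ +-cancelˡ (f (+ n)) (∑[ x < N ] g (1ℤ + x)) (∑ N g) step ⟩
    (∑[ x < N ] f (+ n + x))            ≡⟨ ∑-shift-ℕ N per n ⟩
    ∑ N f                               ∎
    where
    open ≡-Reasoning
    eq₀ : ∀ n x → (1ℤ + n) + x ≡ n + (1ℤ + x)
    eq₀ = solve-∀
    eq₁ : ∀ n N → n + (N + 0ℤ) ≡ n + N * 1ℤ
    eq₁ = solve-∀
    g : ℤ → ℤ
    g x = f (+ n + x)
    +-cancelˡ : ∀ a b c → a + b ≡ a + c → b ≡ c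
    +-cancelˡ a b c e = trans (eq a b) (trans (cong (_- a) e) (sym (eq a c)))
      where
      eq : ∀ a b → b ≡ a + b - a
      eq = solve-∀
    -- The `N + 1` consecutive values from `n` on are summed twice, split off at the first and at
    -- the last value; by periodicity these two values agree.
    step : f (+ n) + (∑[ x < N ] g (1ℤ + x)) ≡ f (+ n) + ∑ N g
    step = begin
      f (+ n) + (∑[ x < N ] g (1ℤ + x))   ≡⟨ cong (λ z → f z + (∑[ x < N ] g (1ℤ + x))) (sym (+-identityʳ (+ n))) ⟩
      ∑ (1 ℕ.+ N) g                       ≡⟨ cong (λ k → ∑ k g) (ℕ.+-comm 1 N) ⟩
      ∑ (N ℕ.+ 1) g                       ≡⟨ ∑-++ N 1 g ⟩
      ∑ N g + (g (+ N + 0ℤ) + 0ℤ)         ≡⟨ cong₂ _+_ (refl {x = ∑ N g}) (+-identityʳ _) ⟩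
      ∑ N g + f (+ n + (+ N + 0ℤ))        ≡⟨ cong₂ _+_ (refl {x = ∑ N g}) (trans (cong f (eq₁ (+ n) (+ N))) (per _ _)) ⟩
      ∑ N g + f (+ n)                     ≡⟨ +-comm (∑ N g) (f (+ n)) ⟩
      f (+ n) + ∑ N g                     ∎

  ∑-shift : ∀ N {f} → Periodic N f → ∀ c → (∑[ x < N ] f (c + x)) ≡ ∑ N f
  ∑-shift N per (+ n) = ∑-shift-ℕ N per n
  ∑-shift N {f} per c@(-[1+ n ]) = trans (sym (∑-shift-ℕ N per′ (suc n)))
      (∑-cong N λ x → cong f (eq (+ (suc n)) x))
    where
    eq : ∀ k x → - k + (k + x) ≡ x
    eq = solve-∀
    per′ : Periodic N (λ x → f (c + x))
    per′ x y = trans (cong f (sym (+-assoc c x _))) (per _ _)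

  -- Opaque, so that unification compares δ N x by its arguments and not by the unfolded test.
  opaque
    δ : ℕ → ℤ → ℤ
    δ N x = if does (N ℕ.∣? ∣ x ∣) then 1ℤ else 0ℤ

    δ-1 : ∀ {N x} → + N ∣ x → δ N x ≡ 1ℤ
    δ-1 {N} {x} d = cong (λ b → if b then 1ℤ else 0ℤ) (dec-true (N ℕ.∣? ∣ x ∣) (∣⇒∣ᵤ d))

    δ-0 : ∀ {N x} → ¬ + N ∣ x → δ N x ≡ 0ℤ
    δ-0 {N} {x} d = cong (λ b → if b then 1ℤ else 0ℤ) (dec-false (N ℕ.∣? ∣ x ∣) (d ∘ ∣ᵤ⇒∣))

  δ-resp : ∀ {M N x y} → (+ M ∣ x → + N ∣ y) → (+ N ∣ y → + M ∣ x) → δ M x ≡ δ N y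
  δ-resp {M} {N} {x} {y} f g with + M ∣? x
  ... | yes p = trans (δ-1 p) (sym (δ-1 (f p)))
  ... | no ¬p = trans (δ-0 ¬p) (sym (δ-0 (¬p ∘ g)))

  δ-periodic : ∀ N → Periodic N (δ N)
  δ-periodic N x y = δ-resp (λ d → ∣m+n∣n⇒∣m d (∣m⇒∣m*n y ∣-refl))
    (λ d → ∣m∣n⇒∣m+n d (∣m⇒∣m*n y ∣-refl))

  δ-neg : ∀ N x → δ N (- x) ≡ δ N x
  δ-neg N x = δ-resp (λ d → subst (+ N ∣_) (neg-involutive x) (∣m⇒∣-m d)) ∣m⇒∣-m

  δ-scale : ∀ M N .{{_ : NonZero M}} x → δ (M ℕ.* N) (+ M * x) ≡ δ N x
  δ-scale M@(suc _) N x = δ-resp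
    (λ d → *-cancelˡ-∣ (+ M) (subst (_∣ (+ M * x)) (pos-* M N) d))
    (λ d → subst (_∣ (+ M * x)) (sym (pos-* M N)) (*-monoʳ-∣ (+ M) d))

  -- Where the indicator does not vanish, `x` and `c` differ by a multiple of the period.
  δ-subst : ∀ N {f} → Periodic N f → ∀ x c → δ N (x - c) * f x ≡ δ N (x - c) * f c
  δ-subst N {f} per x c with + N ∣? (x - c)
  ... | no ¬d = trans (cong (_* f x) (δ-0 ¬d)) (sym (cong (_* f c) (δ-0 ¬d)))
  ... | yes (divides q eq) = cong (δ N (x - c) *_)
      (trans (cong f (trans (e x c) (cong₂ _+_ (refl {x = c}) (trans eq (*-comm q (+ N)))))) (per c q))
    where
    e : ∀ x c → x ≡ c + (x - c)
    e = solve-∀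

  ∑-at : ∀ n {f} r → r ℕ.< n → (∀ i → i ℕ.< n → i ≢ r → f (+ i) ≡ 0ℤ) → ∑ n f ≡ f (+ r)
  ∑-at (suc n) {f} zero    r<n vanish = trans (cong₂ _+_ (refl {x = f 0ℤ})
    (trans (∑-cong-< n λ i i<n → vanish (suc i) (ℕ.s<s i<n) λ ()) (∑-0 n))) (+-identityʳ (f 0ℤ))
  ∑-at (suc n) {f} (suc r) r<n vanish = trans (cong₂ _+_ (vanish 0 ℕ.z<s λ ())
    (∑-at n r (ℕ.s<s⁻¹ r<n) λ i i<n i≢r → vanish (suc i) (ℕ.s<s i<n) (i≢r ∘ ℕ.suc-injective)))
    (+-identityˡ (f (+ suc r)))

  -- In contrast to `∑-sift`, `f` may be any function, at the price that `r` is itself one of the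
  -- summation indices. This generality serves sums over lifts, which need not be periodic in the
  -- residue.
  ∑-residue : ∀ N r → r ℕ.< N → ∀ (f : ℤ → ℤ) → (∑[ x < N ] δ N (x - + r) * f x) ≡ f (+ r)
  ∑-residue N r r<N f = begin
    (∑[ x < N ] δ N (x - + r) * f x)   ≡⟨ ∑-at N r r<N (λ i i<N i≢r → cong (_* f (+ i)) (δ-0 {N} {+ i - + r} (nonmultiple i i<N i≢r))) ⟩
    δ N (+ r - + r) * f (+ r)          ≡⟨ cong (_* f (+ r)) (δ-1 {N} {+ r - + r} (divides 0ℤ (+-inverseʳ (+ r)))) ⟩
    1ℤ * f (+ r)                       ≡⟨ *-identityˡ (f (+ r)) ⟩
    f (+ r)                            ∎
    where
    open ≡-Reasoning
    -- The distance of two indices is at most their maximum, hence below `N`, so it is a multiple of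
    -- `N` only if it is zero.
    nonmultiple : ∀ i → i ℕ.< N → i ≢ r → ¬ + N ∣ (+ i - + r)
    nonmultiple i i<N i≢r d with ∣ + i - + r ∣ in eq
    ... | zero  = i≢r (+-injective (i-j≡0⇒i≡j (+ i) (+ r) (∣i∣≡0⇒i≡0 eq)))
    ... | suc k = ℕ.>⇒∤ (subst (ℕ._< N) (trans (cong ∣_∣ (sym (m-n≡m⊖n i r))) eq)
                    (ℕ.≤-<-trans (∣m⊝n∣≤m⊔n i r) (ℕ.⊔-lub i<N r<N)))
                  (subst (N ℕ.∣_) eq (∣⇒∣ᵤ d))

  ∑-δ : ∀ N .{{_ : NonZero N}} c → (∑[ x < N ] δ N (x - c)) ≡ 1ℤ
  ∑-δ N c = begin
    (∑[ x < N ] δ N (x - c))          ≡⟨ ∑-cong N (λ x → cong (δ N) (eq₁ x c)) ⟩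
    (∑[ x < N ] δ N (- c + x))        ≡⟨ ∑-shift N (δ-periodic N) (- c) ⟩
    (∑[ x < N ] δ N x)                ≡⟨ ∑-cong N (λ x → trans (cong (δ N) (eq₂ x)) (sym (*-identityʳ (δ N (x - 0ℤ))))) ⟩
    (∑[ x < N ] δ N (x - 0ℤ) * 1ℤ)    ≡⟨ ∑-residue N 0 (ℕ.>-nonZero⁻¹ N) (λ _ → 1ℤ) ⟩
    1ℤ                                ∎
    where
    open ≡-Reasoning
    eq₁ : ∀ x c → x - c ≡ - c + x
    eq₁ = solve-∀
    eq₂ : ∀ x → x ≡ x - 0ℤ
    eq₂ = solve-∀

  ∑-sift : ∀ N .{{_ : NonZero N}} {f} → Periodic N f → ∀ c → (∑[ x < N ] δ N (x - c) * f x) ≡ f c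
  ∑-sift N {f} per c = begin
    (∑[ x < N ] δ N (x - c) * f x)   ≡⟨ ∑-cong N (λ x → δ-subst N per x c) ⟩
    (∑[ x < N ] δ N (x - c) * f c)   ≡⟨ ∑-*ʳ N _ (f c) ⟩
    (∑[ x < N ] δ N (x - c)) * f c   ≡⟨ cong (_* f c) (∑-δ N c) ⟩
    1ℤ * f c                         ≡⟨ *-identityˡ (f c) ⟩
    f c                              ∎
    where open ≡-Reasoning

  private variable n : ℕ

  -- Sums over boxes of integer vectors

  -- Plain nesting makes a sum over six coordinates definitionally equal to a double sum over two
  -- triples, that is, over two matrices.
  ∑ᵛ : ℕ → (Vec ℤ n → ℤ) → ℤ
  ∑ᵛ {zero}  N f = f []
  ∑ᵛ {suc n} N f = ∑[ x < N ] ∑ᵛ N (λ v → f (x ∷ v))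

  ∑ᵛ-cong : ∀ N {f g : Vec ℤ n → ℤ} → (∀ v → f v ≡ g v) → ∑ᵛ N f ≡ ∑ᵛ N g
  ∑ᵛ-cong {zero}  N h = h []
  ∑ᵛ-cong {suc n} N h = ∑-cong N λ x → ∑ᵛ-cong N λ v → h (x ∷ v)

  ∑ᵛ-*ˡ : ∀ N c (f : Vec ℤ n → ℤ) → ∑ᵛ N (λ v → c * f v) ≡ c * ∑ᵛ N f
  ∑ᵛ-*ˡ {zero}  N c f = refl
  ∑ᵛ-*ˡ {suc n} N c f = trans (∑-cong N λ x → ∑ᵛ-*ˡ N c (λ v → f (x ∷ v))) (∑-*ˡ N c _)

  ∑ᵛ-*ʳ : ∀ N (f : Vec ℤ n → ℤ) c → ∑ᵛ N (λ v → f v * c) ≡ ∑ᵛ N f * c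
  ∑ᵛ-*ʳ {zero}  N f c = refl
  ∑ᵛ-*ʳ {suc n} N f c = trans (∑-cong N λ x → ∑ᵛ-*ʳ N (λ v → f (x ∷ v)) c) (∑-*ʳ N _ c)

  ∑ᵛ-+ : ∀ N (f g : Vec ℤ n → ℤ) → ∑ᵛ N (λ v → f v + g v) ≡ ∑ᵛ N f + ∑ᵛ N g
  ∑ᵛ-+ {zero}  N f g = refl
  ∑ᵛ-+ {suc n} N f g = trans (∑-cong N λ x → ∑ᵛ-+ N (λ v → f (x ∷ v)) (λ v → g (x ∷ v)))
    (∑-+ N _ _)

  ∑ᵛ-− : ∀ N (f g : Vec ℤ n → ℤ) → ∑ᵛ N (λ v → f v - g v) ≡ ∑ᵛ N f - ∑ᵛ N g
  ∑ᵛ-− {zero}  N f g = refl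
  ∑ᵛ-− {suc n} N f g = trans (∑-cong N λ x → ∑ᵛ-− N (λ v → f (x ∷ v)) (λ v → g (x ∷ v)))
    (∑-− N _ _)

  ∑ᵛ-const : ∀ n N c → ∑ᵛ {n} N (λ _ → c) ≡ (+ N) ^ n * c
  ∑ᵛ-const zero    N c = sym (*-identityˡ c)
  ∑ᵛ-const (suc n) N c = begin
    (∑[ x < N ] ∑ᵛ {n} N (λ _ → c))   ≡⟨ ∑-const N _ ⟩
    + N * ∑ᵛ {n} N (λ _ → c)          ≡⟨ cong (+ N *_) (∑ᵛ-const n N c) ⟩
    + N * ((+ N) ^ n * c)             ≡⟨ sym (*-assoc (+ N) _ c) ⟩
    (+ N) ^ suc n * c                 ∎
    where open ≡-Reasoning

  ∑-∑ᵛ-swap : ∀ M N (f : ℤ → Vec ℤ n → ℤ) →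
    (∑[ x < M ] ∑ᵛ N (f x)) ≡ ∑ᵛ N (λ v → ∑[ x < M ] f x v)
  ∑-∑ᵛ-swap {zero}  M N f = refl
  ∑-∑ᵛ-swap {suc n} M N f = trans (∑-swap M N _)
    (∑-cong N λ y → ∑-∑ᵛ-swap M N (λ x v → f x (y ∷ v)))

  infixl 6 _⊕_·_
  -- One operation covers three uses: lifting a residue (`c` the modulus), translating (`c = 1`) and
  -- scaling (`x = 0`).
  _⊕_·_ : Vec ℤ n → ℤ → Vec ℤ n → Vec ℤ n
  x ⊕ c · h = zipWith (λ a b → a + c * b) x h

  ∑ᵛ-digits : ∀ a b (f : Vec ℤ n → ℤ) →
    ∑ᵛ (a ℕ.* b) f ≡ ∑ᵛ b (λ x → ∑ᵛ a (λ h → f (x ⊕ + b · h)))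
  ∑ᵛ-digits {zero}  a b f = refl
  ∑ᵛ-digits {suc n} a b f = begin
    (∑[ x < a ℕ.* b ] ∑ᵛ (a ℕ.* b) (λ v → f (x ∷ v)))
      ≡⟨ ∑-digits a b _ ⟩
    (∑[ h < a ] ∑[ x < b ] ∑ᵛ (a ℕ.* b) (λ v → f (x + + b * h ∷ v)))
      ≡⟨ ∑-swap a b _ ⟩
    (∑[ x < b ] ∑[ h < a ] ∑ᵛ (a ℕ.* b) (λ v → f (x + + b * h ∷ v)))
      ≡⟨ ∑-cong b (λ x → ∑-cong a λ h → ∑ᵛ-digits a b (λ v → f (x + + b * h ∷ v))) ⟩
    (∑[ x < b ] ∑[ h < a ] ∑ᵛ b (λ v → ∑ᵛ a (λ k → f (x + + b * h ∷ v ⊕ + b · k))))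
      ≡⟨ ∑-cong b (λ x → ∑-∑ᵛ-swap a b (λ h v → ∑ᵛ a (λ k → f (x + + b * h ∷ v ⊕ + b · k)))) ⟩
    (∑[ x < b ] ∑ᵛ b (λ v → ∑[ h < a ] ∑ᵛ a (λ k → f (x + + b * h ∷ v ⊕ + b · k))))
      ∎
    where open ≡-Reasoning

  Periodicᵛ : ℕ → (Vec ℤ n → ℤ) → Set
  Periodicᵛ N f = ∀ x h → f (x ⊕ + N · h) ≡ f x

  ∑ᵛ-periodic : ∀ a b {f : Vec ℤ n → ℤ} → Periodicᵛ b f → ∑ᵛ (a ℕ.* b) f ≡ (+ a) ^ n * ∑ᵛ b f
  ∑ᵛ-periodic {n} a b {f} per = begin
    ∑ᵛ (a ℕ.* b) f                                ≡⟨ ∑ᵛ-digits a b f ⟩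
    ∑ᵛ b (λ x → ∑ᵛ a (λ h → f (x ⊕ + b · h)))     ≡⟨ ∑ᵛ-cong b (λ x → trans (∑ᵛ-cong a (per x)) (∑ᵛ-const n a (f x))) ⟩
    ∑ᵛ b (λ x → (+ a) ^ n * f x)                  ≡⟨ ∑ᵛ-*ˡ b ((+ a) ^ n) f ⟩
    (+ a) ^ n * ∑ᵛ b f                            ∎
    where open ≡-Reasoning

  δᵛ : ℕ → Vec ℤ n → Vec ℤ n → ℤ
  δᵛ N []      []      = 1ℤ
  δᵛ N (r ∷ s) (x ∷ v) = δ N (x - r) * δᵛ N s v

  ∑ᵛ-δᵛ : ∀ N (r : Vec ℕ n) → All (ℕ._< N) r → ∀ (f : Vec ℤ n → ℤ) →
    ∑ᵛ N (λ v → δᵛ N (map +_ r) v * f v) ≡ f (map +_ r)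
  ∑ᵛ-δᵛ N []      _           f = *-identityˡ (f [])
  ∑ᵛ-δᵛ N (r ∷ s) (r<N ∷ s<N) f = begin
    (∑[ x < N ] ∑ᵛ N (λ v → δ N (x - + r) * δᵛ N s⁺ v * f (x ∷ v)))
      ≡⟨ ∑-cong N (λ x → ∑ᵛ-cong N λ v → *-assoc (δ N (x - + r)) (δᵛ N s⁺ v) (f (x ∷ v))) ⟩
    (∑[ x < N ] ∑ᵛ N (λ v → δ N (x - + r) * (δᵛ N s⁺ v * f (x ∷ v))))
      ≡⟨ ∑-cong N (λ x → ∑ᵛ-*ˡ N (δ N (x - + r)) (λ v → δᵛ N s⁺ v * f (x ∷ v))) ⟩
    (∑[ x < N ] δ N (x - + r) * ∑ᵛ N (λ v → δᵛ N s⁺ v * f (x ∷ v)))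
      ≡⟨ ∑-cong N (λ x → cong (δ N (x - + r) *_) (∑ᵛ-δᵛ N s s<N (λ v → f (x ∷ v)))) ⟩
    (∑[ x < N ] δ N (x - + r) * f (x ∷ s⁺))
      ≡⟨ ∑-residue N r r<N (λ x → f (x ∷ s⁺)) ⟩
    f (map +_ (r ∷ s))
      ∎
    where
    open ≡-Reasoning
    s⁺ = map +_ s

  δᵛ-periodic : ∀ N (r : Vec ℤ n) → Periodicᵛ N (δᵛ N r)
  δᵛ-periodic N []      []      []      = refl
  δᵛ-periodic N (r ∷ s) (x ∷ v) (h ∷ k) = cong₂ _*_
    (trans (cong (δ N) (eq x (+ N * h) r)) (δ-periodic N (x - r) h)) (δᵛ-periodic N s v k)
    where
    eq : ∀ x y r → x + y - r ≡ x - r + y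
    eq = solve-∀

  -- Splitting each coordinate as residue plus `N` times lift leaves only the residue `r`. This
  -- isolates a singular class and introduces the coordinates `h` in which it is rescaled.
  ∑ᵛ-residues : ∀ M N (r : Vec ℕ n) → All (ℕ._< N) r → ∀ (f : Vec ℤ n → ℤ) →
    ∑ᵛ (M ℕ.* N) (λ v → δᵛ N (map +_ r) v * f v) ≡ ∑ᵛ M (λ h → f (map +_ r ⊕ + N · h))
  ∑ᵛ-residues M N r r<N f = begin
    ∑ᵛ (M ℕ.* N) (λ v → δᵛ N r⁺ v * f v)
      ≡⟨ ∑ᵛ-digits M N (λ v → δᵛ N r⁺ v * f v) ⟩
    ∑ᵛ N (λ x → ∑ᵛ M (λ h → δᵛ N r⁺ (x ⊕ + N · h) * f (x ⊕ + N · h)))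
      ≡⟨ ∑ᵛ-cong N (λ x → ∑ᵛ-cong M λ h → cong (_* f (x ⊕ + N · h)) (δᵛ-periodic N r⁺ x h)) ⟩
    ∑ᵛ N (λ x → ∑ᵛ M (λ h → δᵛ N r⁺ x * f (x ⊕ + N · h)))
      ≡⟨ ∑ᵛ-cong N (λ x → ∑ᵛ-*ˡ M (δᵛ N r⁺ x) (λ h → f (x ⊕ + N · h))) ⟩
    ∑ᵛ N (λ x → δᵛ N r⁺ x * ∑ᵛ M (λ h → f (x ⊕ + N · h)))
      ≡⟨ ∑ᵛ-δᵛ N r r<N (λ x → ∑ᵛ M (λ h → f (x ⊕ + N · h))) ⟩
    ∑ᵛ M (λ h → f (r⁺ ⊕ + N · h))
      ∎
    where
    open ≡-Reasoning
    r⁺ = map +_ r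

  -- Hensel lifting

  dot : Vec ℤ n → Vec ℤ n → ℤ
  dot []      []      = 0ℤ
  dot (a ∷ u) (b ∷ v) = a * b + dot u v

  +-cast : ∀ a b c d e → e ℕ.+ a ℕ.* b ≡ c ℕ.* d → + e + + a * + b ≡ + c * + d
  +-cast a b c d e eq = trans (cong₂ _+_ (refl {x = + e}) (sym (pos-* a b)))
    (trans (cong +_ eq) (pos-* c d))

  module PrimeModulus {ℓ : ℕ} (ℓ-prime : Prime ℓ) where

    instance
      ℓ≢0 : NonZero ℓ
      ℓ≢0 = prime⇒nonZero ℓ-prime

    L : ℤ
    L = + ℓ

    -- Bézout's identity for `p` and `ℓ`. It comes in two sign patterns over the naturals; in the
    -- second one the inverse is the negated coefficient.
    inverse-ℕ : ∀ p → ¬ ℓ ℕ.∣ p → ∃₂ λ p⁻¹ z → + p * p⁻¹ ≡ 1ℤ + L * z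
    inverse-ℕ p ¬ℓ∣p with ℕ.coprime-Bézout coprime
      where
      coprime : ℕ.Coprime p ℓ
      coprime (d∣p , d∣ℓ) with prime⇒irreducible ℓ-prime d∣ℓ
      ... | inj₁ d≡1  = d≡1
      ... | inj₂ refl = contradiction d∣p ¬ℓ∣p
    ... | Bézout.+- x y eq = + x , + y , trans (*-comm (+ p) (+ x))
      (trans (sym (+-cast y ℓ x p 1 eq)) (cong₂ _+_ (refl {x = 1ℤ}) (*-comm (+ y) L)))
    ... | Bézout.-+ x y eq = - + x , - + y , trans (arith (+ p) (+ x))
      (trans (cong (λ u → 1ℤ - u) (+-cast x p y ℓ 1 eq)) (arith′ (+ y) L))
      where
      arith : ∀ p x → p * (- x) ≡ 1ℤ - (1ℤ + x * p)
      arith = solve-∀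
      arith′ : ∀ y L → 1ℤ - y * L ≡ 1ℤ + L * (- y)
      arith′ = solve-∀

    inverse : ∀ p → ¬ L ∣ p → ∃₂ λ p⁻¹ z → p * p⁻¹ ≡ 1ℤ + L * z
    inverse p@(+ n) ¬ℓ∣p = inverse-ℕ n (¬ℓ∣p ∘ ∣ᵤ⇒∣)
    inverse p@(-[1+ n ]) ¬ℓ∣p with inverse-ℕ (suc n) (¬ℓ∣p ∘ ∣ᵤ⇒∣)
    ... | p⁻¹ , z , eq = - p⁻¹ , z , trans (arith (+ suc n) p⁻¹) eq
      where
      arith : ∀ p q → (- p) * (- q) ≡ p * q
      arith = solve-∀

    -- A linear congruence with unit coefficient has the single root `- (p⁻¹ * y)`; `solved` and
    -- `unsolved` are the two directions of this equivalence.
    ∑-unit : ∀ p → ¬ L ∣ p → ∀ y → (∑[ h < ℓ ] δ ℓ (y + p * h)) ≡ 1ℤ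
    ∑-unit p ¬ℓ∣p y with inverse p ¬ℓ∣p
    ... | p⁻¹ , z , inv = trans
      (∑-cong ℓ λ h → δ-resp
        (λ d → subst (L ∣_) (solved h) (∣m∣n⇒∣m-n (∣n⇒∣m*n p⁻¹ d) (∣m⇒∣m*n (z * h) ∣-refl)))
        (λ d → subst (L ∣_) (unsolved h) (∣m∣n⇒∣m-n (∣n⇒∣m*n p d) (∣m⇒∣m*n (z * y) ∣-refl))))
      (∑-δ ℓ (- (p⁻¹ * y)))
      where
      open ≡-Reasoning
      solved : ∀ h → p⁻¹ * (y + p * h) - L * (z * h) ≡ h - - (p⁻¹ * y)
      solved h = begin
        p⁻¹ * (y + p * h) - L * (z * h)          ≡⟨ a₁ p p⁻¹ y h L z ⟩
        p⁻¹ * y + ((p * p⁻¹) * h - L * (z * h))  ≡⟨ cong (λ u → p⁻¹ * y + (u * h - L * (z * h))) inv ⟩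
        p⁻¹ * y + ((1ℤ + L * z) * h - L * (z * h)) ≡⟨ a₂ p⁻¹ y h L z ⟩
        h - - (p⁻¹ * y)                          ∎
        where
        a₁ : ∀ p q y h L z → q * (y + p * h) - L * (z * h) ≡ q * y + ((p * q) * h - L * (z * h))
        a₁ = solve-∀
        a₂ : ∀ q y h L z → q * y + ((1ℤ + L * z) * h - L * (z * h)) ≡ h - - (q * y)
        a₂ = solve-∀
      unsolved : ∀ h → p * (h - - (p⁻¹ * y)) - L * (z * y) ≡ y + p * h
      unsolved h = begin
        p * (h - - (p⁻¹ * y)) - L * (z * y)      ≡⟨ a₁ p p⁻¹ y h L z ⟩
        p * h + ((p * p⁻¹) * y - L * (z * y))    ≡⟨ cong (λ u → p * h + (u * y - L * (z * y))) inv ⟩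
        p * h + ((1ℤ + L * z) * y - L * (z * y)) ≡⟨ a₂ p y h L z ⟩
        y + p * h                                ∎
        where
        a₁ : ∀ p q y h L z → p * (h - - (q * y)) - L * (z * y) ≡ p * h + ((p * q) * y - L * (z * y))
        a₁ = solve-∀
        a₂ : ∀ p y h L z → p * h + ((1ℤ + L * z) * y - L * (z * y)) ≡ y + p * h
        a₂ = solve-∀

    -- The number of points of an affine hyperplane over the field with ℓ elements: a coordinate
    -- with unit coefficient is determined by the other `n`.
    ∑ᵛ-linear : (g : Vec ℤ (suc n)) → Any (λ a → ¬ L ∣ a) g → ∀ y →
      ∑ᵛ ℓ (λ h → δ ℓ (y + dot g h)) ≡ L ^ n
    ∑ᵛ-linear {n} (a ∷ g) (here unit) y = begin
      (∑[ x < ℓ ] ∑ᵛ ℓ (λ h → δ ℓ (y + (a * x + dot g h))))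
        ≡⟨ ∑-∑ᵛ-swap ℓ ℓ (λ x h → δ ℓ (y + (a * x + dot g h))) ⟩
      ∑ᵛ ℓ (λ h → ∑[ x < ℓ ] δ ℓ (y + (a * x + dot g h)))
        ≡⟨ ∑ᵛ-cong ℓ (λ h → trans (∑-cong ℓ λ x → cong (δ ℓ) (arith y (a * x) (dot g h)))
             (∑-unit a unit (y + dot g h))) ⟩
      ∑ᵛ {n} ℓ (λ _ → 1ℤ)
        ≡⟨ trans (∑ᵛ-const n ℓ 1ℤ) (*-identityʳ (L ^ n)) ⟩
      L ^ n
        ∎
      where
      open ≡-Reasoning
      arith : ∀ y z d → y + (z + d) ≡ (y + d) + z
      arith = solve-∀
    ∑ᵛ-linear {suc n} (a ∷ g) (there units) y = begin
      (∑[ x < ℓ ] ∑ᵛ ℓ (λ h → δ ℓ (y + (a * x + dot g h))))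
        -- The unit lies further on, so the head coordinate is free and its term joins the constant.
        ≡⟨ ∑-cong ℓ (λ x → trans (∑ᵛ-cong ℓ λ h → cong (δ ℓ) (sym (+-assoc y (a * x) (dot g h))))
             (∑ᵛ-linear g units (y + a * x))) ⟩
      (∑[ x < ℓ ] L ^ n)
        ≡⟨ ∑-const ℓ (L ^ n) ⟩
      L ^ suc n
        ∎
      where open ≡-Reasoning

    δ-cancel-power : ∀ M .{{_ : NonZero M}} x y → δ (ℓ ℕ.* M) (x * + M + + M * y) ≡ δ ℓ (x + y)
    δ-cancel-power M x y = trans
      (cong₂ δ (ℕ.*-comm ℓ M) (arith x (+ M) y)) (δ-scale M ℓ (x + y))
      where
      arith : ∀ x M y → x * M + M * y ≡ M * (x + y)
      arith = solve-∀

    ℓ^≢0 : ∀ j → NonZero (ℓ ℕ.^ j)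
    ℓ^≢0 j = ℕ.m^n≢0 ℓ j

    -- Only the divisibility of the remainder by `M * M` is recorded. Stated over the integers for
    -- every `M`, it serves all moduli of the lifting at once.
    Taylor : (f : Vec ℤ n → ℤ) (∇f : Vec ℤ n → Vec ℤ n) → Set
    Taylor f ∇f = ∀ M x h → ∃ λ z → f (x ⊕ M · h) ≡ f x + M * dot (∇f x) h + M * M * z

    -- Hensel's lemma for weighted counts. The weight `w` has to vanish at the points that are
    -- singular modulo ℓ; being periodic, it takes the same value at all lifts of a point and
    -- factors out of the count of lifts.
    module Hensel {f w : Vec ℤ (suc n) → ℤ} {∇f : Vec ℤ (suc n) → Vec ℤ (suc n)}
      (taylor : Taylor f ∇f) (w-periodic : Periodicᵛ ℓ w)
      (smooth : ∀ x → w x ≡ 0ℤ ⊎ Any (λ a → ¬ L ∣ a) (∇f x)) where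

      F : ℕ → Vec ℤ (suc n) → ℤ
      F N x = w x * δ N (f x)

      module _ (j : ℕ) where
        M = ℓ ℕ.^ suc j

        w-periodic-M : Periodicᵛ M w
        w-periodic-M x h = trans (cong w (assoc x h)) (w-periodic x (map (+ (ℓ ℕ.^ j) *_) h))
          where
          assoc : ∀ {m} (x h : Vec ℤ m) → x ⊕ + M · h ≡ x ⊕ L · map (+ (ℓ ℕ.^ j) *_) h
          assoc []      []      = refl
          assoc (x ∷ v) (h ∷ k) = cong₂ _∷_
            (cong₂ _+_ (refl {x = x}) (trans (cong (_* h) (pos-* ℓ (ℓ ℕ.^ j))) (*-assoc L (+ (ℓ ℕ.^ j)) h)))
            (assoc v k)

        -- The remainder carries `M * M`, which is a multiple of `ℓ * M` because `M` is a positive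
        -- power of ℓ.
        linearise : ∀ x h → δ (ℓ ℕ.* M) (f (x ⊕ + M · h)) ≡ δ (ℓ ℕ.* M) (f x + + M * dot (∇f x) h)
        linearise x h with taylor (+ M) x h
        ... | z , eq = trans (cong (δ (ℓ ℕ.* M)) (trans eq (cong₂ _+_ (refl {x = f x + + M * dot (∇f x) h}) square)))
                         (δ-periodic (ℓ ℕ.* M) _ (+ (ℓ ℕ.^ j) * z))
          where
          arith : ∀ L P z → (L * P) * (L * P) * z ≡ (L * (L * P)) * (P * z)
          arith = solve-∀
          M≡ : + M ≡ L * + (ℓ ℕ.^ j)
          M≡ = pos-* ℓ (ℓ ℕ.^ j)
          square : + M * + M * z ≡ + (ℓ ℕ.* M) * (+ (ℓ ℕ.^ j) * z)
          square = trans (cong (λ u → u * u * z) M≡) (trans (arith L (+ (ℓ ℕ.^ j)) z)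
            (cong (_* (+ (ℓ ℕ.^ j) * z)) (sym (trans (pos-* ℓ M) (cong (L *_) M≡)))))

        -- If `f x` is `q * M`, dividing the linearised congruence by `M` leaves a hyperplane in `h`
        -- modulo ℓ. If `M` does not divide `f x`, no lift can be a zero, since a zero modulo
        -- `ℓ * M` would be one modulo `M`.
        lifts : ∀ x → Any (λ a → ¬ L ∣ a) (∇f x) →
          ∑ᵛ ℓ (λ h → δ (ℓ ℕ.* M) (f (x ⊕ + M · h))) ≡ L ^ n * δ M (f x)
        lifts x unit with + M ∣? f x
        ... | yes d@(divides q eq) = begin
          ∑ᵛ ℓ (λ h → δ (ℓ ℕ.* M) (f (x ⊕ + M · h)))
            ≡⟨ ∑ᵛ-cong ℓ (λ h → trans (linearise x h)
                 (trans (cong (λ y → δ (ℓ ℕ.* M) (y + + M * dot (∇f x) h)) eq) (δ-cancel-power M {{ℓ^≢0 (suc j)}} q (dot (∇f x) h)))) ⟩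
          ∑ᵛ ℓ (λ h → δ ℓ (q + dot (∇f x) h))
            ≡⟨ ∑ᵛ-linear (∇f x) unit q ⟩
          L ^ n
            ≡⟨ sym (trans (cong (L ^ n *_) (δ-1 d)) (*-identityʳ (L ^ n))) ⟩
          L ^ n * δ M (f x)
            ∎
          where open ≡-Reasoning
        ... | no ¬d = begin
          ∑ᵛ ℓ (λ h → δ (ℓ ℕ.* M) (f (x ⊕ + M · h)))
            ≡⟨ ∑ᵛ-cong ℓ (λ h → trans (linearise x h) (δ-0 (¬d ∘ λ d →
                 ∣m+n∣n⇒∣m (∣-trans (divides L (pos-* ℓ M)) d) (∣m⇒∣m*n _ ∣-refl)))) ⟩
          ∑ᵛ {suc n} ℓ (λ _ → 0ℤ)
            ≡⟨ trans (∑ᵛ-const (suc n) ℓ 0ℤ) (*-zeroʳ (L ^ suc n)) ⟩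
          0ℤ
            ≡⟨ sym (trans (cong (L ^ n *_) (δ-0 ¬d)) (*-zeroʳ (L ^ n))) ⟩
          L ^ n * δ M (f x)
            ∎
          where open ≡-Reasoning

        weighted-lifts : ∀ x → w x * ∑ᵛ ℓ (λ h → δ (ℓ ℕ.* M) (f (x ⊕ + M · h))) ≡ L ^ n * F M x
        weighted-lifts x with smooth x
        ... | inj₂ unit = trans (cong (w x *_) (lifts x unit)) (arith (w x) (L ^ n) (δ M (f x)))
          where
          arith : ∀ a b c → a * (b * c) ≡ b * (a * c)
          arith = solve-∀
        ... | inj₁ w≡0 = trans (cong (_* ∑ᵛ ℓ (λ h → δ (ℓ ℕ.* M) (f (x ⊕ + M · h)))) w≡0)
          (sym (trans (cong (λ u → L ^ n * (u * δ M (f x))) w≡0) (*-zeroʳ (L ^ n))))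

        hensel-step : ∑ᵛ (ℓ ℕ.* M) (F (ℓ ℕ.* M)) ≡ L ^ n * ∑ᵛ M (F M)
        hensel-step = begin
          ∑ᵛ (ℓ ℕ.* M) (F (ℓ ℕ.* M))
            ≡⟨ ∑ᵛ-digits ℓ M (F (ℓ ℕ.* M)) ⟩
          ∑ᵛ M (λ x → ∑ᵛ ℓ (λ h → w (x ⊕ + M · h) * δ (ℓ ℕ.* M) (f (x ⊕ + M · h))))
            ≡⟨ ∑ᵛ-cong M (λ x → ∑ᵛ-cong ℓ λ h → cong (_* δ (ℓ ℕ.* M) (f (x ⊕ + M · h))) (w-periodic-M x h)) ⟩
          ∑ᵛ M (λ x → ∑ᵛ ℓ (λ h → w x * δ (ℓ ℕ.* M) (f (x ⊕ + M · h))))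
            ≡⟨ ∑ᵛ-cong M (λ x → trans (∑ᵛ-*ˡ ℓ (w x) (λ h → δ (ℓ ℕ.* M) (f (x ⊕ + M · h)))) (weighted-lifts x)) ⟩
          ∑ᵛ M (λ x → L ^ n * F M x)
            ≡⟨ ∑ᵛ-*ˡ M (L ^ n) (F M) ⟩
          L ^ n * ∑ᵛ M (F M)
            ∎
          where open ≡-Reasoning

      hensel : ∀ j → ∑ᵛ (ℓ ℕ.^ suc j) (F (ℓ ℕ.^ suc j)) ≡ (L ^ n) ^ j * ∑ᵛ ℓ (F ℓ)
      hensel zero    = trans (cong (λ N → ∑ᵛ N (F N)) (ℕ.*-identityʳ ℓ)) (sym (*-identityˡ (∑ᵛ ℓ (F ℓ))))
      hensel (suc j) = trans (hensel-step j) (trans (cong (L ^ n *_) (hensel j))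
        (sym (*-assoc (L ^ n) ((L ^ n) ^ j) (∑ᵛ ℓ (F ℓ)))))

  ⊕-zeroʳ : ∀ (x : Vec ℤ n) c → x ⊕ c · replicate n 0ℤ ≡ x
  ⊕-zeroʳ []      c = refl
  ⊕-zeroʳ (x ∷ v) c = cong₂ _∷_ (trans (cong₂ _+_ (refl {x = x}) (*-zeroʳ c)) (+-identityʳ x)) (⊕-zeroʳ v c)

  ∑ᵛ-translate : ∀ N {f : Vec ℤ n → ℤ} → Periodicᵛ N f → ∀ r → ∑ᵛ N (λ v → f (r ⊕ 1ℤ · v)) ≡ ∑ᵛ N f
  ∑ᵛ-translate {zero}  N {f} per []      = refl
  ∑ᵛ-translate {suc n} N {f} per (r ∷ s) = begin
    (∑[ x < N ] ∑ᵛ N (λ v → f (r + 1ℤ * x ∷ s ⊕ 1ℤ · v)))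
      ≡⟨ ∑-cong N (λ x → ∑ᵛ-translate N (per-tail (r + 1ℤ * x)) s) ⟩
    (∑[ x < N ] ∑ᵛ N (λ v → f (r + 1ℤ * x ∷ v)))
      ≡⟨ ∑-cong N (λ x → cong (λ y → ∑ᵛ N (λ v → f (r + y ∷ v))) (*-identityˡ x)) ⟩
    (∑[ x < N ] ∑ᵛ N (λ v → f (r + x ∷ v)))
      ≡⟨ ∑-shift N per-head r ⟩
    (∑[ x < N ] ∑ᵛ N (λ v → f (x ∷ v)))
      ∎
    where
    open ≡-Reasoning
    per-tail : ∀ x → Periodicᵛ N (λ v → f (x ∷ v))
    per-tail x v h = trans (cong (λ y → f (y ∷ v ⊕ + N · h)) (sym (trans (cong₂ _+_ (refl {x = x}) (*-zeroʳ (+ N))) (+-identityʳ x))))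
      (per (x ∷ v) (0ℤ ∷ h))
    per-head : Periodic N (λ x → ∑ᵛ N (λ v → f (x ∷ v)))
    per-head x y = ∑ᵛ-cong N λ v → trans (cong (λ u → f (x + + N * y ∷ u)) (sym (⊕-zeroʳ v (+ N))))
      (per (x ∷ v) (y ∷ replicate n 0ℤ))

  -- Pairs of matrices of trace t with equal determinant

  -- The determinant of a matrix (a b ; c t - a) of trace t.
  q : ℤ → Vec ℤ 3 → ℤ
  q t (a ∷ b ∷ c ∷ []) = a * (t - a) - b * c

  left right : Vec ℤ 6 → Vec ℤ 3
  left  (a ∷ b ∷ c ∷ _) = a ∷ b ∷ c ∷ []
  right (_ ∷ _ ∷ _ ∷ A) = A

  Δ : ℤ → Vec ℤ 6 → ℤ
  Δ t v = q t (left v) - q t (right v)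

  ∇Δ : ℤ → Vec ℤ 6 → Vec ℤ 6
  ∇Δ t (a ∷ b ∷ c ∷ a′ ∷ b′ ∷ c′ ∷ []) =
    t - + 2 * a ∷ - c ∷ - b ∷ - (t - + 2 * a′) ∷ c′ ∷ b′ ∷ []

  -- The homogeneous quadratic part of `q t` is `q 0ℤ`, and the linear term is obtained by
  -- polarisation. For periodicity it matters only that it is an integer.
  q-taylor : ∀ t M A h → q t (A ⊕ M · h) ≡ q t A + M * (q t (A ⊕ 1ℤ · h) - q t A - q 0ℤ h) + M * M * q 0ℤ h
  q-taylor t M (a ∷ b ∷ c ∷ []) (x ∷ y ∷ z ∷ []) = arith t M a b c x y z
    where
    arith : ∀ t M a b c x y z →
      (a + M * x) * (t - (a + M * x)) - (b + M * y) * (c + M * z) ≡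
      (a * (t - a) - b * c) + M * (((a + 1ℤ * x) * (t - (a + 1ℤ * x)) - (b + 1ℤ * y) * (c + 1ℤ * z)) - (a * (t - a) - b * c) - (x * (0ℤ - x) - y * z))
        + M * M * (x * (0ℤ - x) - y * z)
    arith = solve-∀

  -- The expansion is exact, since `Δ t` is quadratic with homogeneous part `Δ 0ℤ`.
  Δ-taylor : ∀ t M v h → Δ t (v ⊕ M · h) ≡ Δ t v + M * dot (∇Δ t v) h + M * M * Δ 0ℤ h
  Δ-taylor t M (a ∷ b ∷ c ∷ a′ ∷ b′ ∷ c′ ∷ []) (x ∷ y ∷ z ∷ x′ ∷ y′ ∷ z′ ∷ []) =
    trans (cong₂ _-_ (arith t M a b c x y z) (arith t M a′ b′ c′ x′ y′ z′))
      (collect M (q t (a ∷ b ∷ c ∷ [])) (q t (a′ ∷ b′ ∷ c′ ∷ [])) (q 0ℤ (x ∷ y ∷ z ∷ [])) (q 0ℤ (x′ ∷ y′ ∷ z′ ∷ []))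
        ((t - + 2 * a) * x) (- c * y) (- b * z) (t - + 2 * a′) x′ c′ y′ b′ z′)
    where
    arith : ∀ t M a b c x y z →
      (a + M * x) * (t - (a + M * x)) - (b + M * y) * (c + M * z) ≡
      (a * (t - a) - b * c) + M * ((t - + 2 * a) * x + (- c * y + - b * z)) + M * M * (x * (0ℤ - x) - y * z)
    arith = solve-∀
    collect : ∀ M p p′ r r′ u v w g x′ c′ y′ b′ z′ →
      (p + M * (u + (v + w)) + M * M * r) - (p′ + M * (g * x′ + (- c′ * y′ + - b′ * z′)) + M * M * r′) ≡
      (p - p′) + M * (u + (v + (w + (- g * x′ + (c′ * y′ + (b′ * z′ + 0ℤ)))))) + M * M * (r - r′)
    collect = solve-∀

  Δ-scale : ∀ c v → Δ 0ℤ (replicate 6 0ℤ ⊕ c · v) ≡ c * c * Δ 0ℤ v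
  Δ-scale k (a ∷ b ∷ c ∷ a′ ∷ b′ ∷ c′ ∷ []) =
    trans (cong₂ _-_ (arith k a b c) (arith k a′ b′ c′))
      (sym (*-distribˡ-− (k * k) (q 0ℤ (a ∷ b ∷ c ∷ [])) (q 0ℤ (a′ ∷ b′ ∷ c′ ∷ []))))
    where
    arith : ∀ k a b c → (0ℤ + k * a) * (0ℤ - (0ℤ + k * a)) - (0ℤ + k * b) * (0ℤ + k * c) ≡
      k * k * (a * (0ℤ - a) - b * c)
    arith = solve-∀
    *-distribˡ-− : ∀ k x y → k * (x - y) ≡ k * x - k * y
    *-distribˡ-− = solve-∀

  -- From list sums to counts of points on a quadric

  -- The index map `h` is general because `upTo n` is `applyUpTo id n`, whose tail applies a shifted
  -- map.
  sum-∑ : ∀ n (f h : ℕ → ℕ) (g : ℤ → ℤ) → (∀ i → + f (h i) ≡ g (+ i)) →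
    + sum (mapᴸ f (applyUpTo h n)) ≡ ∑ n g
  sum-∑ zero    f h g eq = refl
  sum-∑ (suc n) f h g eq = cong₂ _+_ (eq 0) (sum-∑ n f (h ∘ suc) (λ x → g (1ℤ + x)) (λ i → eq (suc i)))

  sum-filter : ∀ {P : ℕ → Set} (P? : Decidable P) (f : ℕ → ℕ) xs →
    sum (mapᴸ f (filter P? xs)) ≡ sum (mapᴸ (λ x → if does (P? x) then f x else 0) xs)
  sum-filter P? f []       = refl
  sum-filter P? f (x ∷ xs) with does (P? x)
  ... | true  = cong (f x ℕ.+_) (sum-filter P? f xs)
  ... | false = sum-filter P? f xs

  opaque
    unfolding δ
    δ-∧ : ∀ N x y → + (if does (N ℕ.∣? ∣ x ∣) ∧ does (N ℕ.∣? ∣ y ∣) then 1 else 0) ≡ δ N x * δ N y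
    δ-∧ N x y = ite (does (N ℕ.∣? ∣ x ∣)) (does (N ℕ.∣? ∣ y ∣))
      where
      ite : ∀ a b → + (if a ∧ b then 1 else 0) ≡ (if a then 1ℤ else 0ℤ) * (if b then 1ℤ else 0ℤ)
      ite true  true  = refl
      ite true  false = refl
      ite false b     = sym (*-zeroˡ (if b then 1ℤ else 0ℤ))

  -- The trace condition forces `d ≡ t - a`, so sifting removes the fourth entry.
  m-∑ : ∀ t u N .{{_ : NonZero N}} → + m t u N ≡ ∑ᵛ N (λ A → δ N (q t A - u))
  m-∑ t u N =
    sum-∑ N _ id _ λ a → sum-∑ N _ id _ λ b → sum-∑ N _ id _ λ c → trans
      (sum-∑ N _ id (λ d → δ N (d - (t - + a)) * δ N (+ a * d - + b * + c - u)) λ d →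
        trans (δ-∧ N (+ a + + d - t) (+ a * + d - + b * + c - u))
          (cong (λ z → δ N z * δ N (+ a * + d - + b * + c - u)) (arith (+ a) (+ d) t)))
      (∑-sift N {λ d → δ N (+ a * d - + b * + c - u)}
        (λ d y → trans (cong (δ N) (arith′ (+ a) d (+ b * + c) u (+ N) y)) (δ-periodic N _ (+ a * y)))
        (t - + a))
    where
    arith : ∀ a d t → a + d - t ≡ d - (t - a)
    arith = solve-∀
    arith′ : ∀ a d e u N y → a * (d + N * y) - e - u ≡ (a * d - e - u) + N * (a * y)
    arith′ = solve-∀

  module _ {ℓ : ℕ} (ℓ-prime : Prime ℓ) where
    open PrimeModulus ℓ-prime

    unit : ℤ → ℤ
    unit x = 1ℤ - δ ℓ x

    -- A residue is a unit modulo a positive power of ℓ exactly when ℓ does not divide it;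
    -- `coprime-^` strips one factor ℓ at a time from a common divisor.
    unit-coprime : ∀ j u x → + (if does (gcd u (ℓ ℕ.^ suc j) ℕ.≟ 1) then x else 0) ≡ unit (+ u) * + x
    unit-coprime j u x with L ∣? + u
    ... | yes d = trans
      (cong (λ b → + (if b then x else 0)) (dec-false (gcd u (ℓ ℕ.^ suc j) ℕ.≟ 1) λ g≡1 →
        contradiction (ℕ.∣1⇒≡1 (subst (ℓ ℕ.∣_) g≡1 (gcd-greatest (∣⇒∣ᵤ d) (ℕ.m∣m*n (ℓ ℕ.^ j)))))
          (ℕ.nonTrivial⇒≢1 {{prime⇒nonTrivial ℓ-prime}})))
      (sym (trans (cong (λ y → (1ℤ - y) * + x) (δ-1 d)) (*-zeroˡ (+ x))))
    ... | no ¬d = trans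
      (cong (λ b → + (if b then x else 0)) (dec-true (gcd u (ℓ ℕ.^ suc j) ℕ.≟ 1) (ℕ.coprime⇒gcd≡1 (coprime-^ (suc j)))))
      (sym (trans (cong (λ y → (1ℤ - y) * + x) (δ-0 ¬d)) (*-identityˡ (+ x))))
      where
      coprime-^ : ∀ j → ℕ.Coprime u (ℓ ℕ.^ j)
      coprime-^ zero    (_ , d∣1) = ℕ.∣1⇒≡1 d∣1
      coprime-^ (suc j) {e} (e∣u , e∣) = coprime-^ j (e∣u , ℕ.coprime-divisor coprime-e e∣)
        where
        coprime-e : ℕ.Coprime e ℓ
        coprime-e (d∣e , d∣ℓ) with prime⇒irreducible ℓ-prime d∣ℓ
        ... | inj₁ d≡1  = d≡1
        ... | inj₂ refl = contradiction (∣ᵤ⇒∣ (ℕ.∣-trans d∣e e∣u)) ¬d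

    unit-periodic : ∀ x y → unit (x + L * y) ≡ unit x
    unit-periodic x y = cong (λ z → 1ℤ - z) (δ-periodic ℓ x y)

    unit-periodic-^ : ∀ j → Periodic (ℓ ℕ.^ suc j) unit
    unit-periodic-^ j x y = trans
      (cong unit (cong₂ _+_ (refl {x = x}) (trans (cong (_* y) (pos-* ℓ (ℓ ℕ.^ j))) (*-assoc L (+ (ℓ ℕ.^ j)) y))))
      (unit-periodic x (+ (ℓ ℕ.^ j) * y))

    -- The square of `m` counts ordered pairs with common determinant `u`. Summing over `u` first
    -- replaces `u` by the determinant of the left matrix, so the unit condition becomes a weight on
    -- that matrix.
    S-∑ : ∀ t j → let N = ℓ ℕ.^ suc j in
      + S t N ≡ ∑ᵛ N (λ v → unit (q t (left v)) * δ N (Δ t v))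
    S-∑ t j = begin
      + S t N
        ≡⟨ trans (cong +_ (sum-filter (λ u → gcd u N ℕ.≟ 1) (λ u → m t (+ u) N ℕ.* m t (+ u) N) (upTo N)))
             (sum-∑ N _ id (λ u → unit u * (μ u * μ u)) squares) ⟩
      (∑[ u < N ] unit u * (μ u * μ u))
        ≡⟨ ∑-cong N expand ⟩
      (∑[ u < N ] ∑ᵛ {3} N (λ A → ∑ᵛ {3} N (λ B → δ N (u - q t A) * (unit u * δ N (q t B - u)))))
        ≡⟨ ∑-∑ᵛ-swap N N (λ u A → ∑ᵛ {3} N (λ B → δ N (u - q t A) * (unit u * δ N (q t B - u)))) ⟩
      ∑ᵛ {3} N (λ A → ∑[ u < N ] ∑ᵛ {3} N (λ B → δ N (u - q t A) * (unit u * δ N (q t B - u))))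
        ≡⟨ ∑ᵛ-cong N (λ A → ∑-∑ᵛ-swap N N (λ u B → δ N (u - q t A) * (unit u * δ N (q t B - u)))) ⟩
      ∑ᵛ {3} N (λ A → ∑ᵛ {3} N (λ B → ∑[ u < N ] δ N (u - q t A) * (unit u * δ N (q t B - u))))
        ≡⟨ ∑ᵛ-cong N (λ A → ∑ᵛ-cong N λ B → ∑-sift N (periodic (q t B)) (q t A)) ⟩
      ∑ᵛ {3} N (λ A → ∑ᵛ {3} N (λ B → unit (q t A) * δ N (q t B - q t A)))
        ≡⟨ ∑ᵛ-cong N (λ A → ∑ᵛ-cong N λ B → cong (unit (q t A) *_) (flip (q t B) (q t A))) ⟩
      ∑ᵛ {3} N (λ A → ∑ᵛ {3} N (λ B → unit (q t A) * δ N (q t A - q t B)))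
        ≡⟨⟩
      ∑ᵛ N (λ v → unit (q t (left v)) * δ N (Δ t v))
        ∎
      where
      open ≡-Reasoning
      N = ℓ ℕ.^ suc j
      instance
        N≢0 : NonZero N
        N≢0 = ℓ^≢0 (suc j)
      μ : ℤ → ℤ
      μ u = ∑ᵛ {3} N (λ A → δ N (q t A - u))
      flip : ∀ x y → δ N (x - y) ≡ δ N (y - x)
      flip x y = trans (sym (δ-neg N (x - y))) (cong (δ N) (arith x y))
        where
        arith : ∀ x y → - (x - y) ≡ y - x
        arith = solve-∀
      squares : ∀ u → + (if does (gcd u N ℕ.≟ 1) then m t (+ u) N ℕ.* m t (+ u) N else 0) ≡ unit (+ u) * (μ (+ u) * μ (+ u))
      squares u = trans (unit-coprime j u _) (cong (unit (+ u) *_)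
        (trans (pos-* (m t (+ u) N) _) (cong₂ _*_ (m-∑ t (+ u) N) (m-∑ t (+ u) N))))
      expand : ∀ u → unit u * (μ u * μ u) ≡
        ∑ᵛ {3} N (λ A → ∑ᵛ {3} N (λ B → δ N (u - q t A) * (unit u * δ N (q t B - u))))
      expand u = sym (begin
        ∑ᵛ {3} N (λ A → ∑ᵛ {3} N (λ B → δ N (u - q t A) * (unit u * δ N (q t B - u))))
          ≡⟨ ∑ᵛ-cong N (λ A → trans (∑ᵛ-*ˡ N (δ N (u - q t A)) (λ B → unit u * δ N (q t B - u)))
               (cong₂ _*_ (flip u (q t A)) (∑ᵛ-*ˡ N (unit u) (λ B → δ N (q t B - u))))) ⟩
        ∑ᵛ {3} N (λ A → δ N (q t A - u) * (unit u * μ u))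
          ≡⟨ ∑ᵛ-*ʳ N (λ A → δ N (q t A - u)) (unit u * μ u) ⟩
        μ u * (unit u * μ u)
          ≡⟨ arith (μ u) (unit u) ⟩
        unit u * (μ u * μ u) ∎)
        where
        arith : ∀ a b → a * (b * a) ≡ b * (a * a)
        arith = solve-∀
      periodic : ∀ c → Periodic N (λ u → unit u * δ N (c - u))
      periodic c x y = cong₂ _*_ (unit-periodic-^ j x y)
        (trans (cong (δ N) (arith c x (+ N) y)) (δ-periodic N (c - x) (- y)))
        where
        arith : ∀ c x N y → c - (x + N * y) ≡ (c - x) + N * (- y)
        arith = solve-∀

  Δ-periodic : ∀ N t → Periodicᵛ N (λ v → δ N (Δ t v))
  Δ-periodic N t v h = trans
    (cong (δ N) (trans (Δ-taylor t (+ N) v h) (arith (Δ t v) (+ N) (dot (∇Δ t v) h) (Δ 0ℤ h))))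
    (δ-periodic N (Δ t v) (dot (∇Δ t v) h + + N * Δ 0ℤ h))
    where
    arith : ∀ d N g r → d + N * g + N * N * r ≡ d + N * (g + N * r)
    arith = solve-∀

  q-left-periodic : ∀ N {f} → Periodic N f → ∀ t → Periodicᵛ N (λ v → f (q t (left v)))
  q-left-periodic N {f} per t v@(a ∷ b ∷ c ∷ _ ∷ _ ∷ _ ∷ []) h@(x ∷ y ∷ z ∷ _ ∷ _ ∷ _ ∷ []) = trans
    (cong f (trans (q-taylor t (+ N) A k)
      (arith (q t A) (+ N) (q t (A ⊕ 1ℤ · k) - q t A - q 0ℤ k) (q 0ℤ k))))
    (per (q t A) _)
    where
    A = left v
    k = left h
    arith : ∀ d N g r → d + N * g + N * N * r ≡ d + N * (g + N * r)
    arith = solve-∀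

  -- Trace zero, and the class of the origin

  module Recursion {ℓ : ℕ} (ℓ-prime : Prime ℓ) where
    open PrimeModulus ℓ-prime

    pairs : (Vec ℤ 6 → ℤ) → ℕ → ℤ
    pairs W N = ∑ᵛ N (λ v → W v * δ N (Δ 0ℤ v))

    -- The unweighted count, to which the class of the origin is reduced once its weight has become
    -- constant. `T 0` counts the one point modulo 1.
    T : ℕ → ℤ
    T j = ∑ᵛ (ℓ ℕ.^ j) (λ v → δ (ℓ ℕ.^ j) (Δ 0ℤ v))

    unit-at : ℤ → Vec ℤ 6 → ℤ
    unit-at s v = unit ℓ-prime (s * s + q 0ℤ (left v))

    unit-at-periodic : ∀ s → Periodicᵛ ℓ (unit-at s)
    unit-at-periodic s = q-left-periodic ℓ
      (λ x y → trans (cong (unit ℓ-prime) (sym (+-assoc (s * s) x (L * y)))) (unit-periodic ℓ-prime (s * s + x) y)) 0ℤ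

    -- Completing the square: a = s + a′ turns a (t - a) into s² - a′².
    S-pairs : ∀ t s y j → t ≡ + 2 * s + + (ℓ ℕ.^ suc j) * y →
      + S t (ℓ ℕ.^ suc j) ≡ pairs (unit-at s) (ℓ ℕ.^ suc j)
    S-pairs t s y j t≡ = begin
      + S t N
        ≡⟨ S-∑ ℓ-prime t j ⟩
      ∑ᵛ N (λ v → unit ℓ-prime (q t (left v)) * δ N (Δ t v))
        ≡⟨ sym (∑ᵛ-translate N (λ x h → cong₂ _*_
             (q-left-periodic N (unit-periodic-^ ℓ-prime j) t x h) (Δ-periodic N t x h)) r) ⟩
      ∑ᵛ N (λ v → unit ℓ-prime (q t (left (r ⊕ 1ℤ · v))) * δ N (Δ t (r ⊕ 1ℤ · v)))
        ≡⟨ ∑ᵛ-cong N translated ⟩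
      pairs (unit-at s) N
        ∎
      where
      open ≡-Reasoning
      N = ℓ ℕ.^ suc j
      r : Vec ℤ 6
      r = s ∷ 0ℤ ∷ 0ℤ ∷ s ∷ 0ℤ ∷ 0ℤ ∷ []
      square : ∀ a b c →
        (s + 1ℤ * a) * (t - (s + 1ℤ * a)) - (0ℤ + 1ℤ * b) * (0ℤ + 1ℤ * c) ≡
        (s * s + (a * (0ℤ - a) - b * c)) + + N * (y * (s + a))
      square a b c = trans
        (cong (λ t → (s + 1ℤ * a) * (t - (s + 1ℤ * a)) - (0ℤ + 1ℤ * b) * (0ℤ + 1ℤ * c)) t≡)
        (arith s (+ N) y a b c)
        where
        arith : ∀ s N y a b c →
          (s + 1ℤ * a) * ((+ 2 * s + N * y) - (s + 1ℤ * a)) - (0ℤ + 1ℤ * b) * (0ℤ + 1ℤ * c) ≡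
          (s * s + (a * (0ℤ - a) - b * c)) + N * (y * (s + a))
        arith = solve-∀
      difference : ∀ s² x x′ N u u′ → (s² + x + N * u) - (s² + x′ + N * u′) ≡ (x - x′) + N * (u - u′)
      difference = solve-∀
      translated : ∀ v → unit ℓ-prime (q t (left (r ⊕ 1ℤ · v))) * δ N (Δ t (r ⊕ 1ℤ · v)) ≡
        unit-at s v * δ N (Δ 0ℤ v)
      translated (a ∷ b ∷ c ∷ a′ ∷ b′ ∷ c′ ∷ []) = cong₂ _*_
        (trans (cong (unit ℓ-prime) (square a b c)) (unit-periodic-^ ℓ-prime j _ (y * (s + a))))
        (trans (cong (δ N) (trans (cong₂ _-_ (square a b c) (square a′ b′ c′))
            (difference (s * s) (q 0ℤ (a ∷ b ∷ c ∷ [])) (q 0ℤ (a′ ∷ b′ ∷ c′ ∷ [])) (+ N) (y * (s + a)) (y * (s + a′)))))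
          (δ-periodic N _ (y * (s + a) - y * (s + a′))))

    0ᵛ : Vec ℤ 6
    0ᵛ = replicate 6 0ℤ

    ℓ>0 : 0 ℕ.< ℓ
    ℓ>0 = ℕ.>-nonZero⁻¹ ℓ

    -- For `v` equal to ℓ times `h`, homogeneity of degree 2 leaves a condition modulo the `j`-th
    -- power of ℓ, while `h` runs modulo one power more; the six surplus digits give `L ^ 6`.
    ∑ᵛ-singular : ∀ {W} → Periodicᵛ ℓ W → ∀ j → let N = ℓ ℕ.^ suc (suc j) in
      ∑ᵛ N (λ v → δᵛ ℓ 0ᵛ v * (W v * δ N (Δ 0ℤ v))) ≡ W 0ᵛ * (L ^ 6 * T j)
    ∑ᵛ-singular {W} W-periodic j = begin
      ∑ᵛ N (λ v → δᵛ ℓ 0ᵛ v * (W v * δ N (Δ 0ℤ v)))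
        ≡⟨ cong (λ K → ∑ᵛ K (λ v → δᵛ ℓ 0ᵛ v * (W v * δ N (Δ 0ℤ v)))) (ℕ.*-comm ℓ (ℓ ℕ.^ suc j)) ⟩
      ∑ᵛ (ℓ ℕ.^ suc j ℕ.* ℓ) (λ v → δᵛ ℓ 0ᵛ v * (W v * δ N (Δ 0ℤ v)))
        ≡⟨ ∑ᵛ-residues (ℓ ℕ.^ suc j) ℓ (replicate 6 0) (ℓ>0 ∷ ℓ>0 ∷ ℓ>0 ∷ ℓ>0 ∷ ℓ>0 ∷ ℓ>0 ∷ [])
             (λ v → W v * δ N (Δ 0ℤ v)) ⟩
      ∑ᵛ (ℓ ℕ.* ℓ ℕ.^ j) (λ h → W (0ᵛ ⊕ L · h) * δ N (Δ 0ℤ (0ᵛ ⊕ L · h)))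
        ≡⟨ ∑ᵛ-cong (ℓ ℕ.* ℓ ℕ.^ j) (λ h → cong₂ _*_ (W-periodic 0ᵛ h) (rescale h)) ⟩
      ∑ᵛ (ℓ ℕ.* ℓ ℕ.^ j) (λ h → W 0ᵛ * δ (ℓ ℕ.^ j) (Δ 0ℤ h))
        ≡⟨ ∑ᵛ-*ˡ (ℓ ℕ.* ℓ ℕ.^ j) (W 0ᵛ) (λ h → δ (ℓ ℕ.^ j) (Δ 0ℤ h)) ⟩
      W 0ᵛ * ∑ᵛ (ℓ ℕ.* ℓ ℕ.^ j) (λ h → δ (ℓ ℕ.^ j) (Δ 0ℤ h))
        ≡⟨ cong (W 0ᵛ *_) (∑ᵛ-periodic ℓ (ℓ ℕ.^ j) (Δ-periodic (ℓ ℕ.^ j) 0ℤ)) ⟩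
      W 0ᵛ * (L ^ 6 * T j)
        ∎
      where
      open ≡-Reasoning
      N = ℓ ℕ.^ suc (suc j)
      rescale : ∀ h → δ N (Δ 0ℤ (0ᵛ ⊕ L · h)) ≡ δ (ℓ ℕ.^ j) (Δ 0ℤ h)
      rescale h = trans
        (cong₂ δ (sym (ℕ.*-assoc ℓ ℓ (ℓ ℕ.^ j))) (trans (Δ-scale L h) (cong (_* Δ 0ℤ h) (sym (pos-* ℓ ℓ)))))
        (δ-scale (ℓ ℕ.* ℓ) (ℓ ℕ.^ j) {{ℕ.m*n≢0 ℓ ℓ}} (Δ 0ℤ h))

  -- Odd primes

  module OddPrime {ℓ : ℕ} (ℓ-prime : Prime ℓ) (ℓ-odd : ¬ + ℓ ∣ + 2) where
    open PrimeModulus ℓ-prime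
    open Recursion ℓ-prime

    euclid : ∀ x y → L ∣ x * y → (L ∣ x) ⊎ (L ∣ y)
    euclid x y d with euclidsLemma ∣ x ∣ ∣ y ∣ ℓ-prime (subst (ℓ ℕ.∣_) (abs-* x y) (∣⇒∣ᵤ d))
    ... | inj₁ p = inj₁ (∣ᵤ⇒∣ p)
    ... | inj₂ p = inj₂ (∣ᵤ⇒∣ p)

    -- Euclid's lemma, written as inclusion and exclusion of indicators.
    δ-* : ∀ x y → δ ℓ (x * y) ≡ δ ℓ x + δ ℓ y - δ ℓ x * δ ℓ y
    δ-* x y with L ∣? x | L ∣? y
    ... | yes p | yes p′ = trans (δ-1 (∣m⇒∣m*n y p)) (sym (cong₂ (λ a b → a + b - a * b) (δ-1 p) (δ-1 p′)))
    ... | yes p | no ¬p′ = trans (δ-1 (∣m⇒∣m*n y p)) (sym (cong₂ (λ a b → a + b - a * b) (δ-1 p) (δ-0 ¬p′)))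
    ... | no ¬p | yes p′ = trans (δ-1 (∣n⇒∣m*n x p′)) (sym (cong₂ (λ a b → a + b - a * b) (δ-0 ¬p) (δ-1 p′)))
    ... | no ¬p | no ¬p′ = trans (δ-0 λ d → [ ¬p , ¬p′ ]′ (euclid x y d))
                             (sym (cong₂ (λ a b → a + b - a * b) (δ-0 ¬p) (δ-0 ¬p′)))

    -- Up to sign the argument is `(a - s) * (a - - s)`. Since ℓ is odd, the roots `s` and `- s`
    -- coincide modulo ℓ only if ℓ divides `s`.
    square-roots : ∀ s → (∑[ a < ℓ ] δ ℓ (s * s + a * (0ℤ - a))) ≡ + 2 - δ ℓ s
    square-roots s = begin
      (∑[ a < ℓ ] δ ℓ (s * s + a * (0ℤ - a)))
        ≡⟨ ∑-cong ℓ pointwise ⟩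
      (∑[ a < ℓ ] δ ℓ (a - s) + δ ℓ (a - - s) - δ ℓ (a - s) * δ ℓ s)
        ≡⟨ ∑-− ℓ (λ a → δ ℓ (a - s) + δ ℓ (a - - s)) (λ a → δ ℓ (a - s) * δ ℓ s) ⟩
      (∑[ a < ℓ ] δ ℓ (a - s) + δ ℓ (a - - s)) - (∑[ a < ℓ ] δ ℓ (a - s) * δ ℓ s)
        ≡⟨ cong₂ _-_
             (trans (∑-+ ℓ (λ a → δ ℓ (a - s)) (λ a → δ ℓ (a - - s))) (cong₂ _+_ (∑-δ ℓ s) (∑-δ ℓ (- s))))
             (trans (∑-*ʳ ℓ (λ a → δ ℓ (a - s)) (δ ℓ s)) (trans (cong (_* δ ℓ s) (∑-δ ℓ s)) (*-identityˡ (δ ℓ s)))) ⟩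
      + 2 - δ ℓ s
        ∎
      where
      open ≡-Reasoning
      factor : ∀ s a → - (s * s + a * (0ℤ - a)) ≡ (a - s) * (a - - s)
      factor = solve-∀
      double : ∀ s → s - - s ≡ + 2 * s
      double = solve-∀
      δ-double : δ ℓ (s - - s) ≡ δ ℓ s
      δ-double = trans (cong (δ ℓ) (double s)) (δ-resp
        (λ d → [ (λ e → contradiction e ℓ-odd) , id ]′ (euclid (+ 2) s d)) (∣n⇒∣m*n (+ 2)))
      shift : ∀ x y s → x + y - - s ≡ x - - s + y
      shift = solve-∀
      pointwise : ∀ a → δ ℓ (s * s + a * (0ℤ - a)) ≡ δ ℓ (a - s) + δ ℓ (a - - s) - δ ℓ (a - s) * δ ℓ s
      pointwise a = trans (sym (δ-neg ℓ (s * s + a * (0ℤ - a)))) (trans (cong (δ ℓ) (factor s a)) (trans (δ-* (a - s) (a - - s))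
        (cong (λ u → δ ℓ (a - s) + δ ℓ (a - - s) - u)
          (trans (δ-subst ℓ {λ x → δ ℓ (x - - s)}
              (λ x y → trans (cong (δ ℓ) (shift x (L * y) s)) (δ-periodic ℓ (x - - s) y)) a s)
            (cong (δ ℓ (a - s) *_) δ-double)))))

    hyperbola : ∀ y → (∑[ b < ℓ ] ∑[ c < ℓ ] δ ℓ (y - b * c)) ≡ L - 1ℤ + L * δ ℓ y
    hyperbola y = begin
      (∑[ b < ℓ ] ∑[ c < ℓ ] δ ℓ (y - b * c))
        ≡⟨ ∑-cong ℓ line ⟩
      (∑[ b < ℓ ] 1ℤ + δ ℓ b * (L * δ ℓ y - 1ℤ))
        ≡⟨ trans (∑-+ ℓ (λ _ → 1ℤ) (λ b → δ ℓ b * (L * δ ℓ y - 1ℤ)))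
             (cong₂ _+_ (∑-const ℓ 1ℤ) (∑-*ʳ ℓ (δ ℓ) (L * δ ℓ y - 1ℤ))) ⟩
      L * 1ℤ + ∑ ℓ (δ ℓ) * (L * δ ℓ y - 1ℤ)
        ≡⟨ cong (λ u → L * 1ℤ + u * (L * δ ℓ y - 1ℤ))
             (trans (∑-cong ℓ λ x → cong (δ ℓ) (sym (+-identityʳ x))) (∑-δ ℓ 0ℤ)) ⟩
      L * 1ℤ + 1ℤ * (L * δ ℓ y - 1ℤ)
        ≡⟨ arith L (δ ℓ y) ⟩
      L - 1ℤ + L * δ ℓ y
        ∎
      where
      open ≡-Reasoning
      arith : ∀ L d → L * 1ℤ + 1ℤ * (L * d - 1ℤ) ≡ L - 1ℤ + L * d
      arith = solve-∀
      yes-case : ∀ u → u ≡ 1ℤ + 1ℤ * (u - 1ℤ)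
      yes-case = solve-∀
      no-case : ∀ u → 1ℤ ≡ 1ℤ + 0ℤ * u
      no-case = solve-∀
      neg-* : ∀ y b c → y - b * c ≡ y + (- b) * c
      neg-* = solve-∀
      multiple : ∀ y k L c → y - k * L * c ≡ y + L * (- (k * c))
      multiple = solve-∀
      -- A unit `b` determines `c`; for `b` divisible by ℓ every `c` or none is a solution. The
      -- right side joins both cases.
      line : ∀ b → (∑[ c < ℓ ] δ ℓ (y - b * c)) ≡ 1ℤ + δ ℓ b * (L * δ ℓ y - 1ℤ)
      line b with L ∣? b
      ... | yes d@(divides k eq) = trans
        (∑-cong ℓ λ c → trans (cong (λ b → δ ℓ (y - b * c)) eq)
          (trans (cong (δ ℓ) (multiple y k L c)) (δ-periodic ℓ y (- (k * c)))))
        (trans (∑-const ℓ (δ ℓ y)) (trans (yes-case (L * δ ℓ y))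
          (cong (λ u → 1ℤ + u * (L * δ ℓ y - 1ℤ)) (sym (δ-1 d)))))
      ... | no ¬d = trans
        (∑-cong ℓ λ c → cong (δ ℓ) (neg-* y b c))
        (trans (∑-unit (- b) (λ d → ¬d (subst (L ∣_) (neg-involutive b) (∣m⇒∣-m d))) y)
          (trans (no-case (L * δ ℓ y - 1ℤ)) (cong (λ u → 1ℤ + u * (L * δ ℓ y - 1ℤ)) (sym (δ-0 ¬d)))))

    quadric : ∀ D → ∑ᵛ ℓ (λ A → δ ℓ (D + q 0ℤ A)) ≡ L * (L - 1ℤ) + L * (∑[ a < ℓ ] δ ℓ (D + a * (0ℤ - a)))
    quadric D = begin
      (∑[ a < ℓ ] ∑[ b < ℓ ] ∑[ c < ℓ ] δ ℓ (D + (a * (0ℤ - a) - b * c)))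
        ≡⟨ ∑-cong ℓ (λ a → trans
             (∑-cong ℓ λ b → ∑-cong ℓ λ c → cong (δ ℓ) (sym (+-assoc D (a * (0ℤ - a)) (- (b * c)))))
             (hyperbola (D + a * (0ℤ - a)))) ⟩
      (∑[ a < ℓ ] L - 1ℤ + L * δ ℓ (D + a * (0ℤ - a)))
        ≡⟨ ∑-+ ℓ (λ _ → L - 1ℤ) (λ a → L * δ ℓ (D + a * (0ℤ - a))) ⟩
      (∑[ a < ℓ ] L - 1ℤ) + (∑[ a < ℓ ] L * δ ℓ (D + a * (0ℤ - a)))
        ≡⟨ cong₂ _+_ (∑-const ℓ (L - 1ℤ)) (∑-*ˡ ℓ L (λ a → δ ℓ (D + a * (0ℤ - a)))) ⟩
      L * (L - 1ℤ) + L * (∑[ a < ℓ ] δ ℓ (D + a * (0ℤ - a)))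
        ∎
      where open ≡-Reasoning

    quadric-square : ∀ s → ∑ᵛ ℓ (λ A → δ ℓ (s * s + q 0ℤ A)) ≡ L * (L - 1ℤ) + L * (+ 2 - δ ℓ s)
    quadric-square s = trans (quadric (s * s)) (cong (λ u → L * (L - 1ℤ) + L * u) (square-roots s))

    -- The number of zeros of a split quadratic form in six variables over the field with ℓ
    -- elements.
    T₁ : ℤ
    T₁ = L ^ 5 + L ^ 3 - L ^ 2

    pairs-mod-ℓ : ∑ᵛ ℓ (λ v → δ ℓ (Δ 0ℤ v)) ≡ T₁
    pairs-mod-ℓ = begin
      ∑ᵛ {3} ℓ (λ A → ∑ᵛ {3} ℓ (λ B → δ ℓ (q 0ℤ A - q 0ℤ B)))
        ≡⟨ ∑ᵛ-cong ℓ (λ A → trans (∑ᵛ-cong ℓ λ B → negate (q 0ℤ A) (q 0ℤ B)) (quadric (- q 0ℤ A))) ⟩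
      ∑ᵛ {3} ℓ (λ A → L * (L - 1ℤ) + L * (∑[ x < ℓ ] δ ℓ (- q 0ℤ A + x * (0ℤ - x))))
        ≡⟨ ∑ᵛ-+ ℓ (λ (A : Vec ℤ 3) → L * (L - 1ℤ)) (λ A → L * (∑[ x < ℓ ] δ ℓ (- q 0ℤ A + x * (0ℤ - x)))) ⟩
      ∑ᵛ {3} ℓ (λ A → L * (L - 1ℤ)) + ∑ᵛ ℓ (λ A → L * (∑[ x < ℓ ] δ ℓ (- q 0ℤ A + x * (0ℤ - x))))
        ≡⟨ cong₂ _+_ (∑ᵛ-const 3 ℓ (L * (L - 1ℤ))) (trans
             (∑ᵛ-*ˡ ℓ L (λ A → ∑[ x < ℓ ] δ ℓ (- q 0ℤ A + x * (0ℤ - x))))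
             (cong (L *_) (sym (∑-∑ᵛ-swap ℓ ℓ (λ x A → δ ℓ (- q 0ℤ A + x * (0ℤ - x))))))) ⟩
      -- After the exchange of sums, the diagonal entry `x` of the second matrix plays the role of
      -- `s`: for fixed `x` the inner sum is again `quadric-square`.
      L ^ 3 * (L * (L - 1ℤ)) + L * (∑[ x < ℓ ] ∑ᵛ {3} ℓ (λ A → δ ℓ (- q 0ℤ A + x * (0ℤ - x))))
        ≡⟨ cong (λ u → L ^ 3 * (L * (L - 1ℤ)) + L * u) (trans
             (∑-cong ℓ λ x → trans (∑ᵛ-cong ℓ λ A → negate′ (q 0ℤ A) x) (quadric-square x)) roots) ⟩
      L ^ 3 * (L * (L - 1ℤ)) + L * (L * (L * (L - 1ℤ)) + L * (L * + 2 - 1ℤ))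
        ≡⟨ arith L ⟩
      T₁
        ∎
      where
      open ≡-Reasoning
      neg-sub : ∀ x y → - (x - y) ≡ - x + y
      neg-sub = solve-∀
      negate : ∀ x y → δ ℓ (x - y) ≡ δ ℓ (- x + y)
      negate x y = trans (sym (δ-neg ℓ (x - y))) (cong (δ ℓ) (neg-sub x y))
      neg-add : ∀ u x → - (- u + x * (0ℤ - x)) ≡ x * x + u
      neg-add = solve-∀
      negate′ : ∀ u x → δ ℓ (- u + x * (0ℤ - x)) ≡ δ ℓ (x * x + u)
      negate′ u x = trans (sym (δ-neg ℓ (- u + x * (0ℤ - x)))) (cong (δ ℓ) (neg-add u x))
      arith : ∀ L → (L * (L * (L * 1ℤ))) * (L * (L - 1ℤ)) + L * (L * (L * (L - 1ℤ)) + L * (L * + 2 - 1ℤ)) ≡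
        L * (L * (L * (L * (L * 1ℤ)))) + L * (L * (L * 1ℤ)) - L * (L * 1ℤ)
      arith = solve-∀
      roots : (∑[ x < ℓ ] L * (L - 1ℤ) + L * (+ 2 - δ ℓ x)) ≡ L * (L * (L - 1ℤ)) + L * (L * + 2 - 1ℤ)
      roots = trans (∑-+ ℓ (λ _ → L * (L - 1ℤ)) (λ x → L * (+ 2 - δ ℓ x))) (cong₂ _+_
        (∑-const ℓ (L * (L - 1ℤ)))
        (trans (∑-*ˡ ℓ L (λ x → + 2 - δ ℓ x)) (cong (L *_) (trans (∑-− ℓ (λ _ → + 2) (δ ℓ))
          (cong₂ _-_ (∑-const ℓ (+ 2))
            (trans (∑-cong ℓ λ x → cong (δ ℓ) (sym (+-identityʳ x))) (∑-δ ℓ 0ℤ)))))))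

    -- Counting the complement: pairs with common determinant zero are independent choices of two
    -- matrices of determinant zero, of which there are `R`.
    unit-pairs-mod-ℓ : ∀ s → let R = L * (L - 1ℤ) + L * (+ 2 - δ ℓ s) in pairs (unit-at s) ℓ ≡ T₁ - R * R
    unit-pairs-mod-ℓ s = begin
      pairs (unit-at s) ℓ
        ≡⟨ ∑ᵛ-cong ℓ (λ v → trans (expand (G v) (δ ℓ (Δ 0ℤ v))) (cong (λ u → δ ℓ (Δ 0ℤ v) - u) (separate v))) ⟩
      ∑ᵛ ℓ (λ v → δ ℓ (Δ 0ℤ v) - G v * G′ v)
        ≡⟨ ∑ᵛ-− ℓ (λ v → δ ℓ (Δ 0ℤ v)) (λ v → G v * G′ v) ⟩
      ∑ᵛ ℓ (λ v → δ ℓ (Δ 0ℤ v)) - ∑ᵛ ℓ (λ v → G v * G′ v)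
        ≡⟨ cong₂ _-_ pairs-mod-ℓ square ⟩
      T₁ - R * R
        ∎
      where
      open ≡-Reasoning
      R = L * (L - 1ℤ) + L * (+ 2 - δ ℓ s)
      H : Vec ℤ 3 → ℤ
      H A = δ ℓ (s * s + q 0ℤ A)
      G G′ : Vec ℤ 6 → ℤ
      G  v = H (left v)
      G′ v = H (right v)
      expand : ∀ g d → (1ℤ - g) * d ≡ d - g * d
      expand = solve-∀
      e₁ : ∀ D x → D + x ≡ x - - D
      e₁ = solve-∀
      e₂ : ∀ D y → - (- D - y) ≡ D + y
      e₂ = solve-∀
      e₃ : ∀ x z y → x + z - y ≡ x - y + z
      e₃ = solve-∀
      separate : ∀ v → G v * δ ℓ (Δ 0ℤ v) ≡ G v * G′ v
      separate v = begin
        δ ℓ (s * s + x) * δ ℓ (x - y)        ≡⟨ cong (λ u → δ ℓ u * δ ℓ (x - y)) (e₁ (s * s) x) ⟩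
        δ ℓ (x - - (s * s)) * δ ℓ (x - y)    ≡⟨ δ-subst ℓ {λ x → δ ℓ (x - y)}
                                                  (λ x z → trans (cong (δ ℓ) (e₃ x (L * z) y)) (δ-periodic ℓ (x - y) z)) x (- (s * s)) ⟩
        δ ℓ (x - - (s * s)) * δ ℓ (- (s * s) - y) ≡⟨ cong₂ _*_ (cong (δ ℓ) (sym (e₁ (s * s) x)))
                                                  (trans (sym (δ-neg ℓ (- (s * s) - y))) (cong (δ ℓ) (e₂ (s * s) y))) ⟩
        δ ℓ (s * s + x) * δ ℓ (s * s + y)    ∎
        where
        x = q 0ℤ (left v)
        y = q 0ℤ (right v)
      square : ∑ᵛ ℓ (λ v → G v * G′ v) ≡ R * R
      square = begin
        ∑ᵛ {3} ℓ (λ A → ∑ᵛ {3} ℓ (λ B → H A * H B))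
          ≡⟨ ∑ᵛ-cong ℓ (λ A → ∑ᵛ-*ˡ ℓ (H A) H) ⟩
        ∑ᵛ {3} ℓ (λ A → H A * ∑ᵛ ℓ H)
          ≡⟨ ∑ᵛ-*ʳ ℓ H (∑ᵛ ℓ H) ⟩
        ∑ᵛ ℓ H * ∑ᵛ ℓ H
          ≡⟨ cong₂ _*_ (quadric-square s) (quadric-square s) ⟩
        R * R ∎

    zero-or-unit : ∀ {n} (v : Vec ℤ n) → δᵛ ℓ (replicate n 0ℤ) v ≡ 1ℤ ⊎ Any (λ a → ¬ L ∣ a) v
    zero-or-unit []      = inj₁ refl
    zero-or-unit (x ∷ v) with L ∣? x
    ... | no ¬d = inj₂ (here ¬d)
    ... | yes d with zero-or-unit v
    ...   | inj₂ any = inj₂ (there any)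
    ...   | inj₁ eq  = inj₁ (cong₂ _*_ (trans (cong (δ ℓ) (+-identityʳ x)) (δ-1 d)) eq)

    -- Up to the factors ±1 and ±2, units for odd ℓ, the gradient permutes the coordinates. Hence
    -- the origin is the only singular point modulo ℓ.
    ∇Δ-unit : ∀ v → Any (λ a → ¬ L ∣ a) v → Any (λ a → ¬ L ∣ a) (∇Δ 0ℤ v)
    ∇Δ-unit (a ∷ b ∷ c ∷ a′ ∷ b′ ∷ c′ ∷ []) any = go any
      where
      negated : ∀ {x} → ¬ L ∣ x → ¬ L ∣ - x
      negated {x} ¬d d = ¬d (subst (L ∣_) (neg-involutive x) (∣m⇒∣-m d))
      doubled : ∀ {x} → ¬ L ∣ x → ¬ L ∣ 0ℤ - + 2 * x
      doubled {x} ¬d d = [ ℓ-odd , ¬d ]′ (euclid (+ 2) x (subst (L ∣_) (eq x) (∣m⇒∣-m d)))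
        where
        eq : ∀ x → - (0ℤ - + 2 * x) ≡ + 2 * x
        eq = solve-∀
      go : Any (λ a → ¬ L ∣ a) (a ∷ b ∷ c ∷ a′ ∷ b′ ∷ c′ ∷ []) → Any (λ a → ¬ L ∣ a) (∇Δ 0ℤ (a ∷ b ∷ c ∷ a′ ∷ b′ ∷ c′ ∷ []))
      go (here d)                                 = here (doubled d)
      go (there (here d))                         = there (there (here (negated d)))
      go (there (there (here d)))                 = there (here (negated d))
      go (there (there (there (here d))))         = there (there (there (here (negated (doubled d)))))
      go (there (there (there (there (here d))))) = there (there (there (there (there (here d)))))
      go (there (there (there (there (there (here d)))))) = there (there (there (there (here d))))

    pairs-step : ∀ {W} → Periodicᵛ ℓ W → ∀ j →
      pairs W (ℓ ℕ.^ suc (suc j)) ≡ (L ^ 5) ^ suc j * (pairs W ℓ - W 0ᵛ) + W 0ᵛ * (L ^ 6 * T j)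
    pairs-step {W} W-periodic j = begin
      pairs W N
        ≡⟨ ∑ᵛ-cong N (λ v → split (W v) (Z v) (δ N (Δ 0ℤ v))) ⟩
      ∑ᵛ N (λ v → w v * δ N (Δ 0ℤ v) + Z v * (W v * δ N (Δ 0ℤ v)))
        ≡⟨ ∑ᵛ-+ N (λ v → w v * δ N (Δ 0ℤ v)) (λ v → Z v * (W v * δ N (Δ 0ℤ v))) ⟩
      pairs w N + ∑ᵛ N (λ v → Z v * (W v * δ N (Δ 0ℤ v)))
        ≡⟨ cong₂ _+_ (trans (Hensel.hensel {f = Δ 0ℤ} taylor w-periodic smooth (suc j)) (cong ((L ^ 5) ^ suc j *_) base)) (∑ᵛ-singular W-periodic j) ⟩
      (L ^ 5) ^ suc j * (pairs W ℓ - W 0ᵛ) + W 0ᵛ * (L ^ 6 * T j)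
        ∎
      where
      open ≡-Reasoning
      N = ℓ ℕ.^ suc (suc j)
      Z w : Vec ℤ 6 → ℤ
      Z = δᵛ ℓ 0ᵛ
      w v = W v * (1ℤ - Z v)
      split : ∀ W Z d → W * d ≡ W * (1ℤ - Z) * d + Z * (W * d)
      split = solve-∀
      taylor : Taylor (Δ 0ℤ) (∇Δ 0ℤ)
      taylor M x h = Δ 0ℤ h , Δ-taylor 0ℤ M x h
      w-periodic : Periodicᵛ ℓ w
      w-periodic x h = cong₂ _*_ (W-periodic x h) (cong (λ u → 1ℤ - u) (δᵛ-periodic ℓ 0ᵛ x h))
      smooth : ∀ x → w x ≡ 0ℤ ⊎ Any (λ a → ¬ L ∣ a) (∇Δ 0ℤ x)
      smooth x with zero-or-unit x
      ... | inj₁ Z≡1 = inj₁ (trans (cong (λ u → W x * (1ℤ - u)) Z≡1) (*-zeroʳ (W x)))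
      ... | inj₂ any = inj₂ (∇Δ-unit x any)
      -- Modulo ℓ the singular class is the single point `0ᵛ`, which lies on the quadric.
      base : pairs w ℓ ≡ pairs W ℓ - W 0ᵛ
      base = begin
        pairs w ℓ
          ≡⟨ ∑ᵛ-cong ℓ (λ v → split′ (W v) (Z v) (δ ℓ (Δ 0ℤ v))) ⟩
        ∑ᵛ ℓ (λ v → W v * δ ℓ (Δ 0ℤ v) - Z v * (W v * δ ℓ (Δ 0ℤ v)))
          ≡⟨ ∑ᵛ-− ℓ (λ v → W v * δ ℓ (Δ 0ℤ v)) (λ v → Z v * (W v * δ ℓ (Δ 0ℤ v))) ⟩
        pairs W ℓ - ∑ᵛ ℓ (λ v → Z v * (W v * δ ℓ (Δ 0ℤ v)))
          ≡⟨ cong (λ u → pairs W ℓ - u) (trans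
               (∑ᵛ-δᵛ ℓ (replicate 6 0) (ℓ>0 ∷ ℓ>0 ∷ ℓ>0 ∷ ℓ>0 ∷ ℓ>0 ∷ ℓ>0 ∷ []) (λ v → W v * δ ℓ (Δ 0ℤ v)))
               (trans (cong (W 0ᵛ *_) (δ-1 {ℓ} {0ℤ} (divides 0ℤ refl))) (*-identityʳ (W 0ᵛ)))) ⟩
        pairs W ℓ - W 0ᵛ
          ∎
        where
        split′ : ∀ W Z d → W * (1ℤ - Z) * d ≡ W * d - Z * (W * d)
        split′ = solve-∀

  -- Parity, fractions and powers

  Parity : ℤ → Set
  Parity x = (∃ λ h → x ≡ + 2 * h) ⊎ (∃ λ h → x ≡ 1ℤ + + 2 * h)

  parity-+ : ∀ n → Parity (+ n)
  parity-+ zero    = inj₁ (0ℤ , refl)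
  parity-+ (suc n) with parity-+ n
  ... | inj₁ (h , eq) = inj₂ (h , cong (λ x → 1ℤ + x) eq)
  ... | inj₂ (h , eq) = inj₁ (1ℤ + h , trans (cong (λ x → 1ℤ + x) eq) (arith h))
    where
    arith : ∀ h → 1ℤ + (1ℤ + + 2 * h) ≡ + 2 * (1ℤ + h)
    arith = solve-∀

  parity : ∀ x → Parity x
  parity (+ n)    = parity-+ n
  parity -[1+ n ] with parity-+ (suc n)
  ... | inj₁ (h , eq) = inj₁ (- h , trans (cong -_ eq) (neg-distribʳ-* (+ 2) h))
  ... | inj₂ (h , eq) = inj₂ (- (1ℤ + h) , trans (cong -_ eq) (arith h))
    where
    arith : ∀ h → - (1ℤ + + 2 * h) ≡ 1ℤ + + 2 * (- (1ℤ + h))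
    arith = solve-∀

  /ℕ-≡ : ∀ p r d e .{{_ : NonZero d}} .{{_ : NonZero e}} → p * + e ≡ r * + d → p /ℕ d ≡ r /ℕ e
  /ℕ-≡ p r (suc d) (suc e) eq = ℚ.fromℚᵘ-cong {ℚᵘ.mkℚᵘ p d} {ℚᵘ.mkℚᵘ r e} (ℚᵘ.*≡* eq)

  -- Passing through unnormalised rationals avoids reducing to lowest terms; what remains of the
  -- theorem is then cross-multiplication in the integers.
  /ℕ-− : ∀ p r d e .{{_ : NonZero d}} .{{_ : NonZero e}} →
    p /ℕ d ℚ.- r /ℕ e ≡ (p * + e - r * + d) /ℕ (d ℕ.* e)
  /ℕ-− p r (suc d) (suc e) = ℚ.toℚᵘ-injective (begin
    ℚ.toℚᵘ (p /ℕ suc d ℚ.- r /ℕ suc e)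
      ≈⟨ ℚ.toℚᵘ-homo-+ (p /ℕ suc d) (ℚ.- (r /ℕ suc e)) ⟩
    ℚ.toℚᵘ (p /ℕ suc d) ℚᵘ.+ ℚ.toℚᵘ (ℚ.- (r /ℕ suc e))
      ≈⟨ ℚᵘ.+-cong (ℚ.toℚᵘ-fromℚᵘ (ℚᵘ.mkℚᵘ p d))
           (ℚᵘ.≃-trans (ℚ.toℚᵘ-homo‿- (r /ℕ suc e)) (ℚᵘ.-‿cong (ℚ.toℚᵘ-fromℚᵘ (ℚᵘ.mkℚᵘ r e)))) ⟩
    ℚᵘ.mkℚᵘ p d ℚᵘ.- ℚᵘ.mkℚᵘ r e
      ≈⟨ ℚᵘ.≃-reflexive (cong (λ n → ℚᵘ.mkℚᵘ n (e ℕ.+ d ℕ.* suc e))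
           (cong₂ _+_ (refl {x = p * + suc e}) (sym (neg-distribˡ-* r (+ suc d))))) ⟩
    ℚᵘ.mkℚᵘ (p * + suc e - r * + suc d) (e ℕ.+ d ℕ.* suc e)
      ≈⟨ ℚᵘ.≃-sym (ℚ.toℚᵘ-fromℚᵘ (ℚᵘ.mkℚᵘ (p * + suc e - r * + suc d) (e ℕ.+ d ℕ.* suc e))) ⟩
    ℚ.toℚᵘ ((p * + suc e - r * + suc d) /ℕ (suc d ℕ.* suc e))
      ∎)
    where open import Relation.Binary.Reasoning.Setoid ℚᵘ.≃-setoid

  pos-^ : ∀ a n → + (a ℕ.^ n) ≡ (+ a) ^ n
  pos-^ a zero    = refl
  pos-^ a (suc n) = trans (pos-* a (a ℕ.^ n)) (cong (+ a *_) (pos-^ a n))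

  ^-*-distrib : ∀ x y n → (x * y) ^ n ≡ x ^ n * y ^ n
  ^-*-distrib x y zero    = refl
  ^-*-distrib x y (suc n) = trans (cong (x * y *_) (^-*-distrib x y n)) (arith x y (x ^ n) (y ^ n))
    where
    arith : ∀ x y a b → x * y * (a * b) ≡ x * a * (y * b)
    arith = solve-∀

  denominator : ∀ ℓ i → + (ℓ ℕ.^ (5 ℕ.* suc i ℕ.∸ 5)) ≡ ((+ ℓ) ^ 5) ^ i
  denominator ℓ i = trans (cong (λ n → + (ℓ ℕ.^ n)) (trans (cong (ℕ._∸ 5) (ℕ.*-suc 5 i)) (ℕ.m+n∸m≡n 5 (5 ℕ.* i))))
    (trans (pos-^ ℓ (5 ℕ.* i)) (sym (^-*-assoc (+ ℓ) 5 i)))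

  ℓ^[2k] : ∀ ℓ k → + (ℓ ℕ.^ (2 ℕ.* k)) ≡ ((+ ℓ) ^ 2) ^ k
  ℓ^[2k] ℓ k = trans (pos-^ ℓ (2 ℕ.* k)) (sym (^-*-assoc (+ ℓ) 2 k))

  -- Closed forms for odd primes

  module OddCase {ℓ : ℕ} (ℓ-prime : Prime ℓ) (ℓ-odd : ¬ + ℓ ∣ + 2) where
    open PrimeModulus ℓ-prime
    open Recursion ℓ-prime
    open OddPrime ℓ-prime ℓ-odd

    T-recurrence : ∀ j → T (2 ℕ.+ j) ≡ (L ^ 5) ^ suc j * (T₁ - 1ℤ) + L ^ 6 * T j
    T-recurrence j = trans
      (∑ᵛ-cong (ℓ ℕ.^ (2 ℕ.+ j)) λ v → sym (*-identityˡ (δ (ℓ ℕ.^ (2 ℕ.+ j)) (Δ 0ℤ v))))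
      (trans (pairs-step {λ _ → 1ℤ} (λ _ _ → refl) j) (cong₂ _+_
        (cong (λ u → (L ^ 5) ^ suc j * (u - 1ℤ)) (trans (∑ᵛ-cong ℓ λ v → *-identityˡ (δ ℓ (Δ 0ℤ v))) pairs-mod-ℓ))
        (*-identityˡ (L ^ 6 * T j))))

    -- The `L ^ 5` term is the particular solution of `T-recurrence`; the `L ^ 3` term solves the
    -- homogeneous recurrence, whose factor is `L ^ 6`. Step 2 requires two initial values. The
    -- factor `L * (L + 1ℤ)` clears denominators.
    T-closed-odd : ∀ j → L * (L + 1ℤ) * T j ≡ (L * L + L + 1ℤ) * (L ^ 5) ^ j - (L ^ 3) ^ j
    T-closed-odd 0 = trans (cong (L * (L + 1ℤ) *_) T₀≡) (arith L)
      where
      T₀≡ : T 0 ≡ 1ℤ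
      T₀≡ = trans (∑ᵛ-cong 1 λ v → δ-1 (divides (Δ 0ℤ v) (sym (*-identityʳ (Δ 0ℤ v))))) (∑ᵛ-const 6 1 1ℤ)
      arith : ∀ L → L * (L + 1ℤ) * 1ℤ ≡ (L * L + L + 1ℤ) * 1ℤ - 1ℤ
      arith = solve-∀
    T-closed-odd 1 = trans
      (cong (L * (L + 1ℤ) *_) (trans (cong (λ N → ∑ᵛ N (λ v → δ N (Δ 0ℤ v))) (ℕ.*-identityʳ ℓ)) pairs-mod-ℓ)) (arith L)
      where
      arith : ∀ L → L * (L + 1ℤ) * (L * (L * (L * (L * (L * 1ℤ)))) + L * (L * (L * 1ℤ)) - L * (L * 1ℤ)) ≡
        (L * L + L + 1ℤ) * (L * (L * (L * (L * (L * 1ℤ)))) * 1ℤ) - L * (L * (L * 1ℤ)) * 1ℤ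
      arith = solve-∀
    T-closed-odd (suc (suc j)) = trans (cong (L * (L + 1ℤ) *_) (T-recurrence j))
      (trans (distribute L ((L ^ 5) ^ j) (T j))
        (trans (cong (λ u → L * (L + 1ℤ) * (L ^ 5 * (L ^ 5) ^ j * (T₁ - 1ℤ)) + L ^ 6 * u) (T-closed-odd j))
          (arith L ((L ^ 5) ^ j) ((L ^ 3) ^ j))))
      where
      distribute : ∀ L x u → let L⁵ = L * (L * (L * (L * (L * 1ℤ)))) ; T₁ = L⁵ + L * (L * (L * 1ℤ)) - L * (L * 1ℤ) in
        L * (L + 1ℤ) * (L⁵ * x * (T₁ - 1ℤ) + L * L⁵ * u) ≡
        L * (L + 1ℤ) * (L⁵ * x * (T₁ - 1ℤ)) + L * L⁵ * (L * (L + 1ℤ) * u)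
      distribute = solve-∀
      arith : ∀ L x y → let L³ = L * (L * (L * 1ℤ)) ; L⁵ = L * (L * L³) ; T₁ = L⁵ + L³ - L * (L * 1ℤ) in
        L * (L + 1ℤ) * (L⁵ * x * (T₁ - 1ℤ)) + L * L⁵ * ((L * L + L + 1ℤ) * x - y) ≡
        (L * L + L + 1ℤ) * (L⁵ * (L⁵ * x)) - L³ * (L³ * y)
      arith = solve-∀

    odd-power : ∀ n → ∃ λ h → + (ℓ ℕ.^ n) ≡ 1ℤ + + 2 * h
    odd-power zero    = 0ℤ , refl
    odd-power (suc n) with parity L | odd-power n
    ... | inj₂ (g , eq) | h , eq′ = g + h + + 2 * (g * h) ,
          trans (pos-* ℓ (ℓ ℕ.^ n)) (trans (cong₂ _*_ eq eq′) (arith g h))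
      where
      arith : ∀ g h → (1ℤ + + 2 * g) * (1ℤ + + 2 * h) ≡ 1ℤ + + 2 * (g + h + + 2 * (g * h))
      arith = solve-∀
    ... | inj₁ (g , eq) | _ with prime⇒irreducible ℓ-prime (∣⇒∣ᵤ (subst (+ 2 ∣_) (sym eq) (∣m⇒∣m*n g ∣-refl)))
    ...   | inj₂ refl = contradiction ∣-refl ℓ-odd

    -- Writing the odd modulus as `1ℤ + + 2 * h` exhibits `- h` as an inverse of 2, so `s` is
    -- `- (t * h)`.
    half-trace : ∀ t j → ∃ λ s → t ≡ + 2 * s + + (ℓ ℕ.^ suc j) * t
    half-trace t j with odd-power (suc j)
    ... | h , eq = - (t * h) , trans (arith t h) (cong (λ N → + 2 * - (t * h) + N * t) (sym eq))
      where
      arith : ∀ t h → t ≡ + 2 * - (t * h) + (1ℤ + + 2 * h) * t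
      arith = solve-∀

    -- The weight at the origin is the unit indicator of `s * s`, that is `1ℤ - e`; so `T` enters
    -- exactly when ℓ does not divide `s`.
    S-recurrence : ∀ t s y j → t ≡ + 2 * s + + (ℓ ℕ.^ (2 ℕ.+ j)) * y →
      let e = δ ℓ s ; R = L * (L - 1ℤ) + L * (+ 2 - e) in
      + S t (ℓ ℕ.^ (2 ℕ.+ j)) ≡ (L ^ 5) ^ suc j * (T₁ - R * R - (1ℤ - e)) + (1ℤ - e) * (L ^ 6 * T j)
    S-recurrence t s y j t≡ = trans (S-pairs t s y (suc j) t≡) (trans (pairs-step (unit-at-periodic s) j)
      (cong₂ (λ a b → (L ^ 5) ^ suc j * (a - b) + b * (L ^ 6 * T j)) (unit-pairs-mod-ℓ s) unit-at-0))
      where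
      square : s * s + 0ℤ ≡ s * s
      square = +-identityʳ (s * s)
      idem : ∀ e → (e ≡ 0ℤ) ⊎ (e ≡ 1ℤ) → e + e - e * e ≡ e
      idem _ (inj₁ refl) = refl
      idem _ (inj₂ refl) = refl
      δ-01 : (δ ℓ s ≡ 0ℤ) ⊎ (δ ℓ s ≡ 1ℤ)
      δ-01 with L ∣? s
      ... | yes d = inj₂ (δ-1 d)
      ... | no ¬d = inj₁ (δ-0 ¬d)
      unit-at-0 : unit-at s 0ᵛ ≡ 1ℤ - δ ℓ s
      unit-at-0 = cong (λ u → 1ℤ - u) (trans (cong (δ ℓ) square) (trans (δ-* s s) (idem (δ ℓ s) δ-01)))

    L∣N* : ∀ j y → L ∣ + (ℓ ℕ.^ suc j) * y
    L∣N* j y = ∣m⇒∣m*n y (∣ᵤ⇒∣ {L} {+ (ℓ ℕ.^ suc j)} (ℕ.m∣m*n (ℓ ℕ.^ j)))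

    normalised-S-ℓ∣t : ∀ t j → L ∣ t → let k = 2 ℕ.+ j in
      (+ S t (ℓ ℕ.^ k)) /ℕ (ℓ ℕ.^ (5 ℕ.* k ℕ.∸ 5)) ≡ (L * L * (L * L + + 1) * (L - + 1)) /ℕ 1
    normalised-S-ℓ∣t t j ℓ∣t with half-trace t (suc j)
    ... | s , t≡ = /ℕ-≡ (+ S t (ℓ ℕ.^ k)) (L * L * (L * L + + 1) * (L - + 1)) (ℓ ℕ.^ (5 ℕ.* k ℕ.∸ 5)) 1 {{ℓ^≢0 (5 ℕ.* k ℕ.∸ 5)}}
      (trans (cong (_* 1ℤ) (trans (S-recurrence t s t j t≡)
          (cong (λ e → (L ^ 5) ^ suc j * (T₁ - (L * (L - 1ℤ) + L * (+ 2 - e)) * (L * (L - 1ℤ) + L * (+ 2 - e)) - (1ℤ - e)) + (1ℤ - e) * (L ^ 6 * T j)) (δ-1 ℓ∣s))))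
        -- With `e` equal to 1 the `T` term is multiplied by zero and `R` is `L * L`, leaving
        -- `T₁ - L ^ 4`.
        (trans (arith L ((L ^ 5) ^ suc j) (L ^ 6 * T j))
          (cong (L * L * (L * L + + 1) * (L - + 1) *_) (sym (denominator ℓ (suc j))))))
      where
      k = 2 ℕ.+ j
      ℓ∣s : L ∣ s
      ℓ∣s with euclid (+ 2) s (∣m+n∣n⇒∣m (subst (L ∣_) t≡ ℓ∣t) (L∣N* (suc j) t))
      ... | inj₁ d = contradiction d ℓ-odd
      ... | inj₂ d = d
      arith : ∀ L D u → let R = L * (L - 1ℤ) + L * (+ 2 - 1ℤ) in
        (D * (L * (L * (L * (L * (L * 1ℤ)))) + L * (L * (L * 1ℤ)) - L * (L * 1ℤ) - R * R - (1ℤ - 1ℤ)) + (1ℤ - 1ℤ) * u) * 1ℤ ≡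
        L * L * (L * L + + 1) * (L - + 1) * D
      arith = solve-∀

    normalised-S-ℓ∤t : ∀ t j → ¬ L ∣ t → let k = 2 ℕ.+ j in
      (+ S t (ℓ ℕ.^ k)) /ℕ (ℓ ℕ.^ (5 ℕ.* k ℕ.∸ 5)) ≡
        (L * L * (L * L * L * L - + 2 * L * L - + 3 * L - + 1)) /ℕ (ℓ ℕ.+ 1)
          ℚ.- (L * L * L * L) /ℕ (ℓ ℕ.^ (2 ℕ.* k) ℕ.* (ℓ ℕ.+ 1))
    normalised-S-ℓ∤t t j ℓ∤t with half-trace t (suc j)
    ... | s , t≡ = trans
      (/ℕ-≡ (+ S t (ℓ ℕ.^ k)) (X * + (Q ℕ.* P) - L * L * L * L * + P) (ℓ ℕ.^ (5 ℕ.* k ℕ.∸ 5)) (P ℕ.* (Q ℕ.* P)) cross)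
      (sym (/ℕ-− X (L * L * L * L) P (Q ℕ.* P)))
      where
      k = 2 ℕ.+ j
      P = ℓ ℕ.+ 1
      Q = ℓ ℕ.^ (2 ℕ.* k)
      X = L * L * (L * L * L * L - + 2 * L * L - + 3 * L - + 1)
      x = (L ^ 5) ^ j
      y = (L ^ 3) ^ j
      z = (L ^ 2) ^ j
      instance
        P≢0 : NonZero P
        P≢0 = ℕ.≢-nonZero λ eq → ℕ.1+n≢0 (trans (ℕ.+-comm 1 ℓ) eq)
        Q≢0 : NonZero Q
        Q≢0 = ℓ^≢0 (2 ℕ.* k)
        QP≢0 : NonZero (Q ℕ.* P)
        QP≢0 = ℕ.m*n≢0 Q P
        PQP≢0 : NonZero (P ℕ.* (Q ℕ.* P))
        PQP≢0 = ℕ.m*n≢0 P (Q ℕ.* P)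
        D≢0 : NonZero (ℓ ℕ.^ (5 ℕ.* k ℕ.∸ 5))
        D≢0 = ℓ^≢0 (5 ℕ.* k ℕ.∸ 5)
      ℓ∤s : ¬ L ∣ s
      ℓ∤s d = ℓ∤t (subst (L ∣_) (sym t≡) (∣m∣n⇒∣m+n (∣n⇒∣m*n (+ 2) d) (L∣N* (suc j) t)))
      -- The powers with exponent `j` are opaque to the ring solver; expressing `x` by `y` and `z`
      -- turns the claim into a polynomial identity in `L`, `y`, `z`.
      xyz : x ≡ y * z
      xyz = trans (cong (_^ j) (arith L)) (^-*-distrib (L ^ 3) (L ^ 2) j)
        where
        arith : ∀ L → L * (L * (L * (L * (L * 1ℤ)))) ≡ L * (L * (L * 1ℤ)) * (L * (L * 1ℤ))
        arith = solve-∀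
      +Q : + Q ≡ L ^ 2 * (L ^ 2 * z)
      +Q = ℓ^[2k] ℓ k
      +P : + P ≡ L + 1ℤ
      +P = pos-+ ℓ 1
      +QP : + (Q ℕ.* P) ≡ L ^ 2 * (L ^ 2 * z) * (L + 1ℤ)
      +QP = trans (pos-* Q P) (cong₂ _*_ +Q +P)
      +PQP : + (P ℕ.* (Q ℕ.* P)) ≡ (L + 1ℤ) * (L ^ 2 * (L ^ 2 * z) * (L + 1ℤ))
      +PQP = trans (pos-* P (Q ℕ.* P)) (cong₂ _*_ +P +QP)
      U = T₁ - (L * (L - 1ℤ) + L * + 2) * (L * (L - 1ℤ) + L * + 2) - 1ℤ
      S≡ : + S t (ℓ ℕ.^ k) ≡ L ^ 5 * x * U + L ^ 6 * T j
      S≡ = trans (S-recurrence t s t j t≡) (trans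
        (cong (λ e → (L ^ 5) ^ suc j * (T₁ - (L * (L - 1ℤ) + L * (+ 2 - e)) * (L * (L - 1ℤ) + L * (+ 2 - e)) - (1ℤ - e)) + (1ℤ - e) * (L ^ 6 * T j)) (δ-0 ℓ∤s))
        (cong₂ _+_ (refl {x = L ^ 5 * x * U}) (*-identityˡ (L ^ 6 * T j))))
      distribute : ∀ L x z U u → let Q = L * (L * 1ℤ) * (L * (L * 1ℤ) * z) ; L⁵ = L * (L * (L * (L * (L * 1ℤ)))) in
        (L⁵ * x * U + L * L⁵ * u) * ((L + 1ℤ) * (Q * (L + 1ℤ))) ≡
        (L⁵ * x * U * (L + 1ℤ) + L⁵ * (L * (L + 1ℤ) * u)) * (Q * (L + 1ℤ))
      distribute = solve-∀
      final : ∀ L y z → let L² = L * (L * 1ℤ) ; L³ = L * L² ; L⁵ = L * (L * L³) ; Q = L² * (L² * z)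
                            R = L * (L - 1ℤ) + L * + 2 ; U = L⁵ + L³ - L² - R * R - 1ℤ in
        (L⁵ * (y * z) * U * (L + 1ℤ) + L⁵ * ((L * L + L + 1ℤ) * (y * z) - y)) * (Q * (L + 1ℤ)) ≡
        (L * L * (L * L * L * L - + 2 * L * L - + 3 * L - + 1) * (Q * (L + 1ℤ)) - L * L * L * L * (L + 1ℤ)) * (L⁵ * (y * z))
      final = solve-∀
      cross : + S t (ℓ ℕ.^ k) * + (P ℕ.* (Q ℕ.* P)) ≡
        (X * + (Q ℕ.* P) - L * L * L * L * + P) * + (ℓ ℕ.^ (5 ℕ.* k ℕ.∸ 5))
      cross = begin
        + S t (ℓ ℕ.^ k) * + (P ℕ.* (Q ℕ.* P))
          ≡⟨ cong₂ _*_ S≡ +PQP ⟩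
        (L ^ 5 * x * U + L ^ 6 * T j) * ((L + 1ℤ) * (L ^ 2 * (L ^ 2 * z) * (L + 1ℤ)))
          -- One factor `L + 1ℤ` of the denominator and one `L` of `L ^ 6` are moved next to `T j`,
          -- to match `T-closed-odd`.
          ≡⟨ distribute L x z U (T j) ⟩
        (L ^ 5 * x * U * (L + 1ℤ) + L ^ 5 * (L * (L + 1ℤ) * T j)) * (L ^ 2 * (L ^ 2 * z) * (L + 1ℤ))
          ≡⟨ cong (λ u → (L ^ 5 * x * U * (L + 1ℤ) + L ^ 5 * u) * (L ^ 2 * (L ^ 2 * z) * (L + 1ℤ))) (T-closed-odd j) ⟩
        (L ^ 5 * x * U * (L + 1ℤ) + L ^ 5 * ((L * L + L + 1ℤ) * x - y)) * (L ^ 2 * (L ^ 2 * z) * (L + 1ℤ))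
          ≡⟨ cong (λ x → (L ^ 5 * x * U * (L + 1ℤ) + L ^ 5 * ((L * L + L + 1ℤ) * x - y)) * (L ^ 2 * (L ^ 2 * z) * (L + 1ℤ))) xyz ⟩
        (L ^ 5 * (y * z) * U * (L + 1ℤ) + L ^ 5 * ((L * L + L + 1ℤ) * (y * z) - y)) * (L ^ 2 * (L ^ 2 * z) * (L + 1ℤ))
          ≡⟨ final L y z ⟩
        (X * (L ^ 2 * (L ^ 2 * z) * (L + 1ℤ)) - L * L * L * L * (L + 1ℤ)) * (L ^ 5 * (y * z))
          ≡⟨ sym (cong₂ _*_ (cong₂ (λ u v → X * u - L * L * L * L * v) +QP +P) (trans (denominator ℓ (suc j)) (cong (L ^ 5 *_) xyz))) ⟩
        (X * + (Q ℕ.* P) - L * L * L * L * + P) * + (ℓ ℕ.^ (5 ℕ.* k ℕ.∸ 5))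
          ∎
        where open ≡-Reasoning

  -- The prime 2

  module TwoAdic where
    open PrimeModulus prime[2]
    open Recursion prime[2]

    2∤1 : ¬ + 2 ∣ 1ℤ
    2∤1 d with ℕ.∣1⇒≡1 (∣⇒∣ᵤ d)
    ... | ()

    odd-nonmultiple : ∀ h → ¬ + 2 ∣ (1ℤ + + 2 * h)
    odd-nonmultiple h d = 2∤1 (∣m+n∣n⇒∣m d (∣m⇒∣m*n h ∣-refl))

    -- Lets the class of odd numbers be treated as the complement of the even ones in ring
    -- identities.
    δ₂-pred : ∀ x → δ 2 (x - 1ℤ) ≡ 1ℤ - δ 2 x
    δ₂-pred x with parity x
    ... | inj₁ (h , refl) = trans (δ-0 λ d → odd-nonmultiple (h - 1ℤ) (subst (+ 2 ∣_) (arith h) d))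
                              (cong (λ u → 1ℤ - u) (sym (δ-1 (∣m⇒∣m*n h ∣-refl))))
      where
      arith : ∀ h → + 2 * h - 1ℤ ≡ 1ℤ + + 2 * (h - 1ℤ)
      arith = solve-∀
    ... | inj₂ (h , refl) = trans (δ-1 (subst (+ 2 ∣_) (sym (arith h)) (∣m⇒∣m*n h ∣-refl)))
                              (cong (λ u → 1ℤ - u) (sym (δ-0 (odd-nonmultiple h))))
      where
      arith : ∀ h → 1ℤ + + 2 * h - 1ℤ ≡ + 2 * h
      arith = solve-∀

    taylor : ∀ t → Taylor (Δ t) (∇Δ t)
    taylor t M x h = Δ 0ℤ h , Δ-taylor t M x h

    ∇Δ-odd : ∀ t y → t ≡ 1ℤ + + 2 * y → ∀ x → Any (λ a → ¬ + 2 ∣ a) (∇Δ t x)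
    ∇Δ-odd t y refl (a ∷ b ∷ c ∷ a′ ∷ b′ ∷ c′ ∷ []) = here
      λ d → odd-nonmultiple (y - a) (subst (+ 2 ∣_) (arith y a) d)
      where
      arith : ∀ y a → 1ℤ + + 2 * y - + 2 * a ≡ 1ℤ + + 2 * (y - a)
      arith = solve-∀

    opaque
      unfolding δ
      -- Over the field with two elements, 2 matrices of trace 1 have determinant 1, giving 2²
      -- pairs.
      odd-count : ∑ᵛ 2 (λ v → unit prime[2] (q 1ℤ (left v)) * δ 2 (Δ 1ℤ v)) ≡ + 4
      odd-count = refl

      -- Of the 8 matrices of trace 1 modulo 2, 6 have determinant 0 and 2 have determinant 1: 6² +
      -- 2² pairs.
      minus-one-count : ∑ᵛ 2 (λ v → 1ℤ * δ 2 (Δ -1ℤ v)) ≡ + 40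
      minus-one-count = refl

    S-odd : ∀ t y j → t ≡ 1ℤ + + 2 * y → + S t (2 ℕ.^ suc j) ≡ (+ 32) ^ j * + 4
    S-odd t y j t≡ = begin
      + S t (2 ℕ.^ suc j)
        ≡⟨ S-∑ prime[2] t j ⟩
      ∑ᵛ (2 ℕ.^ suc j) (λ v → w v * δ (2 ℕ.^ suc j) (Δ t v))
        ≡⟨ Hensel.hensel {f = Δ t} (taylor t) w-periodic (λ x → inj₂ (∇Δ-odd t y t≡ x)) j ⟩
      (+ 32) ^ j * ∑ᵛ 2 (λ v → w v * δ 2 (Δ t v))
        ≡⟨ cong ((+ 32) ^ j *_) (trans (∑ᵛ-cong 2 reduce) odd-count) ⟩
      (+ 32) ^ j * + 4
        ∎
      where
      open ≡-Reasoning
      w : Vec ℤ 6 → ℤ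
      w v = unit prime[2] (q t (left v))
      w-periodic : Periodicᵛ 2 w
      w-periodic = q-left-periodic 2 (unit-periodic prime[2]) t
      q-mod-2 : ∀ a b c → a * (t - a) - b * c ≡ (a * (1ℤ - a) - b * c) + + 2 * (a * y)
      q-mod-2 a b c = trans (cong (λ t → a * (t - a) - b * c) t≡) (arith a b c y)
        where
        arith : ∀ a b c y → a * (1ℤ + + 2 * y - a) - b * c ≡ (a * (1ℤ - a) - b * c) + + 2 * (a * y)
        arith = solve-∀
      difference : ∀ x x′ u u′ → (x + + 2 * u) - (x′ + + 2 * u′) ≡ (x - x′) + + 2 * (u - u′)
      difference = solve-∀
      reduce : ∀ v → w v * δ 2 (Δ t v) ≡ unit prime[2] (q 1ℤ (left v)) * δ 2 (Δ 1ℤ v)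
      reduce (a ∷ b ∷ c ∷ a′ ∷ b′ ∷ c′ ∷ []) = cong₂ _*_
        (trans (cong (unit prime[2]) (q-mod-2 a b c)) (unit-periodic prime[2] _ (a * y)))
        (trans (cong (δ 2) (trans (cong₂ _-_ (q-mod-2 a b c) (q-mod-2 a′ b′ c′))
            (difference (q 1ℤ (a ∷ b ∷ c ∷ [])) (q 1ℤ (a′ ∷ b′ ∷ c′ ∷ [])) (a * y) (a′ * y))))
          (δ-periodic 2 _ (a * y - a′ * y)))

    -- Modulo 2 the gradient (- 2 a, - c, - b, 2 a′, c′, b′) of Δ 0 vanishes exactly on the support of Zᵇ.
    Zᵇ : Vec ℤ 6 → ℤ
    Zᵇ (a ∷ b ∷ c ∷ a′ ∷ b′ ∷ c′ ∷ []) = δ 2 b * (δ 2 c * (δ 2 b′ * δ 2 c′))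

    1ᵛ : Vec ℤ 6
    1ᵛ = map +_ (1 ∷ 0 ∷ 0 ∷ 1 ∷ 0 ∷ 0 ∷ [])

    -- The last factor is the indicator of opposite parity of `a` and `a′`. On the support of `Zᵇ`
    -- the products `b * c` and `b′ * c′` are even, so `Δ 0ℤ` is congruent to the difference of the
    -- squares of `a′` and `a`; at a zero the parities agree.
    same-parity : ∀ {N} → 2 ℕ.∣ N → ∀ a b c a′ b′ c′ →
      let v = a ∷ b ∷ c ∷ a′ ∷ b′ ∷ c′ ∷ [] in
      Zᵇ v * δ N (Δ 0ℤ v) * (δ 2 a + δ 2 a′ - + 2 * (δ 2 a * δ 2 a′)) ≡ 0ℤ
    same-parity {N} 2∣N a b c a′ b′ c′ = cases (+ 2 ∣? b) (+ 2 ∣? b′) (+ N ∣? Δ 0ℤ v)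
      where
      v : Vec ℤ 6
      v = a ∷ b ∷ c ∷ a′ ∷ b′ ∷ c′ ∷ []
      z₁ : ∀ x y z → 0ℤ * x * y * z ≡ 0ℤ
      z₁ = solve-∀
      z₂ : ∀ w x y z u → w * (x * (0ℤ * y)) * z * u ≡ 0ℤ
      z₂ = solve-∀
      z₃ : ∀ x y → x * 0ℤ * y ≡ 0ℤ
      z₃ = solve-∀
      z₄ : ∀ x → x * (1ℤ + 1ℤ - + 2 * (1ℤ * 1ℤ)) ≡ 0ℤ
      z₄ = solve-∀
      z₅ : ∀ x → x * (0ℤ + 0ℤ - + 2 * (0ℤ * 0ℤ)) ≡ 0ℤ
      z₅ = solve-∀
      bool : ∀ x → δ 2 a ≡ δ 2 a′ → x * (δ 2 a + δ 2 a′ - + 2 * (δ 2 a * δ 2 a′)) ≡ 0ℤ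
      bool x eq with + 2 ∣? a
      ... | yes d = trans (cong₂ (λ u u′ → x * (u + u′ - + 2 * (u * u′))) (δ-1 d) (trans (sym eq) (δ-1 d))) (z₄ x)
      ... | no ¬d = trans (cong₂ (λ u u′ → x * (u + u′ - + 2 * (u * u′))) (δ-0 ¬d) (trans (sym eq) (δ-0 ¬d))) (z₅ x)
      square : ∀ x → δ 2 (x * x) ≡ δ 2 x
      square x with parity x
      ... | inj₁ (h , refl) = trans (δ-1 (∣m⇒∣m*n (+ 2 * h) (∣m⇒∣m*n h ∣-refl))) (sym (δ-1 (∣m⇒∣m*n h ∣-refl)))
      ... | inj₂ (h , refl) = trans (δ-0 (odd-nonmultiple (+ 2 * h * h + + 2 * h) ∘ subst (+ 2 ∣_) (arith h))) (sym (δ-0 (odd-nonmultiple h)))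
        where
        arith : ∀ h → (1ℤ + + 2 * h) * (1ℤ + + 2 * h) ≡ 1ℤ + + 2 * (+ 2 * h * h + + 2 * h)
        arith = solve-∀
      arith : ∀ a b c a′ b′ c′ → a * a ≡
        a′ * a′ - ((a * (0ℤ - a) - b * c) - (a′ * (0ℤ - a′) - b′ * c′)) - b * c + b′ * c′
      arith = solve-∀
      cases : Dec (+ 2 ∣ b) → Dec (+ 2 ∣ b′) → Dec (+ N ∣ Δ 0ℤ v) →
        Zᵇ v * δ N (Δ 0ℤ v) * (δ 2 a + δ 2 a′ - + 2 * (δ 2 a * δ 2 a′)) ≡ 0ℤ
      cases (no ¬d) _ _ = trans (cong (λ u → u * (δ 2 c * (δ 2 b′ * δ 2 c′)) * δ N (Δ 0ℤ v) * (δ 2 a + δ 2 a′ - + 2 * (δ 2 a * δ 2 a′))) (δ-0 ¬d))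
        (z₁ (δ 2 c * (δ 2 b′ * δ 2 c′)) (δ N (Δ 0ℤ v)) (δ 2 a + δ 2 a′ - + 2 * (δ 2 a * δ 2 a′)))
      cases _ (no ¬d) _ = trans (cong (λ u → δ 2 b * (δ 2 c * (u * δ 2 c′)) * δ N (Δ 0ℤ v) * (δ 2 a + δ 2 a′ - + 2 * (δ 2 a * δ 2 a′))) (δ-0 ¬d))
        (z₂ (δ 2 b) (δ 2 c) (δ 2 c′) (δ N (Δ 0ℤ v)) (δ 2 a + δ 2 a′ - + 2 * (δ 2 a * δ 2 a′)))
      cases _ _ (no ¬d) = trans (cong (λ u → Zᵇ v * u * (δ 2 a + δ 2 a′ - + 2 * (δ 2 a * δ 2 a′))) (δ-0 ¬d))
        (z₃ (Zᵇ v) (δ 2 a + δ 2 a′ - + 2 * (δ 2 a * δ 2 a′)))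
      cases (yes (divides k b≡)) (yes (divides k′ b′≡)) (yes d)
        with divides g Δ≡ ← ∣-trans (∣ᵤ⇒∣ {+ 2} {+ N} 2∣N) d = bool (Zᵇ v * δ N (Δ 0ℤ v))
        (trans (sym (square a)) (trans (cong (δ 2) (trans (arith a b c a′ b′ c′)
          (trans (cong₂ (λ e f → a′ * a′ - e - f * c + b′ * c′) Δ≡ b≡)
            (trans (cong (λ f → a′ * a′ - g * + 2 - k * + 2 * c + f * c′) b′≡) (collect′ (a′ * a′) g k c k′ c′)))))
          (trans (δ-periodic 2 (a′ * a′) _) (square a′))))
        where
        collect′ : ∀ x g k c k′ c′ → x - g * + 2 - k * + 2 * c + k′ * + 2 * c′ ≡ x + + 2 * (k′ * c′ - k * c - g)
        collect′ = solve-∀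

    -- The singular locus modulo 2 consists of four classes by the parities of `a` and `a′`; the two
    -- mixed ones carry no zeros, by `same-parity`.
    parity-split : ∀ (W : Vec ℤ 6 → ℤ) {N} → 2 ℕ.∣ N → ∀ v → W v * δ N (Δ 0ℤ v) ≡
      W v * (1ℤ - Zᵇ v) * δ N (Δ 0ℤ v) +
      (δᵛ 2 0ᵛ v * (W v * δ N (Δ 0ℤ v)) + δᵛ 2 1ᵛ v * (W v * δ N (Δ 0ℤ v)))
    parity-split W {N} 2∣N v@(a ∷ b ∷ c ∷ a′ ∷ b′ ∷ c′ ∷ []) = begin
      W v * d
        ≡⟨ arith (δ 2 a) (δ 2 b) (δ 2 c) (δ 2 a′) (δ 2 b′) (δ 2 c′) (W v) d ⟩
      smooth + (z (δ 2 a) (δ 2 b) (δ 2 c) (δ 2 a′) (δ 2 b′) (δ 2 c′) * (W v * d)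
        + z (1ℤ - δ 2 a) (δ 2 b) (δ 2 c) (1ℤ - δ 2 a′) (δ 2 b′) (δ 2 c′) * (W v * d))
        + W v * (Zᵇ v * d * (δ 2 a + δ 2 a′ - + 2 * (δ 2 a * δ 2 a′)))
        ≡⟨ cong₂ _+_ (cong (λ u → smooth + u) (cong₂ (λ x y → x * (W v * d) + y * (W v * d)) even odd))
             (trans (cong (W v *_) (same-parity 2∣N a b c a′ b′ c′)) (*-zeroʳ (W v))) ⟩
      smooth + (δᵛ 2 0ᵛ v * (W v * d) + δᵛ 2 1ᵛ v * (W v * d)) + 0ℤ
        ≡⟨ +-identityʳ _ ⟩
      smooth + (δᵛ 2 0ᵛ v * (W v * d) + δᵛ 2 1ᵛ v * (W v * d))
        ∎
      where
      open ≡-Reasoning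
      d = δ N (Δ 0ℤ v)
      smooth = W v * (1ℤ - Zᵇ v) * d
      z : ℤ → ℤ → ℤ → ℤ → ℤ → ℤ → ℤ
      z α β γ α′ β′ γ′ = α * (β * (γ * (α′ * (β′ * (γ′ * 1ℤ)))))
      δ-−0 : ∀ x → δ 2 x ≡ δ 2 (x - 0ℤ)
      δ-−0 x = cong (δ 2) (sym (+-identityʳ x))
      even : z (δ 2 a) (δ 2 b) (δ 2 c) (δ 2 a′) (δ 2 b′) (δ 2 c′) ≡ δᵛ 2 0ᵛ v
      even = cong₂ _*_ (δ-−0 a) (cong₂ _*_ (δ-−0 b) (cong₂ _*_ (δ-−0 c)
        (cong₂ _*_ (δ-−0 a′) (cong₂ _*_ (δ-−0 b′) (cong (_* 1ℤ) (δ-−0 c′))))))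
      odd : z (1ℤ - δ 2 a) (δ 2 b) (δ 2 c) (1ℤ - δ 2 a′) (δ 2 b′) (δ 2 c′) ≡ δᵛ 2 1ᵛ v
      odd = cong₂ _*_ (sym (δ₂-pred a)) (cong₂ _*_ (δ-−0 b) (cong₂ _*_ (δ-−0 c)
        (cong₂ _*_ (sym (δ₂-pred a′)) (cong₂ _*_ (δ-−0 b′) (cong (_* 1ℤ) (δ-−0 c′))))))
      arith : ∀ α β γ α′ β′ γ′ W d → W * d ≡
        W * (1ℤ - β * (γ * (β′ * γ′))) * d
        + (α * (β * (γ * (α′ * (β′ * (γ′ * 1ℤ))))) * (W * d)
          + (1ℤ - α) * (β * (γ * ((1ℤ - α′) * (β′ * (γ′ * 1ℤ))))) * (W * d))
        + W * (β * (γ * (β′ * γ′)) * d * (α + α′ - + 2 * (α * α′)))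
      arith = solve-∀

    Zᵇ-periodic : Periodicᵛ 2 Zᵇ
    Zᵇ-periodic (a ∷ b ∷ c ∷ a′ ∷ b′ ∷ c′ ∷ []) (_ ∷ y ∷ z ∷ _ ∷ y′ ∷ z′ ∷ []) = cong₂ _*_
      (δ-periodic 2 b y) (cong₂ _*_ (δ-periodic 2 c z) (cong₂ _*_ (δ-periodic 2 b′ y′) (δ-periodic 2 c′ z′)))

    smooth-off-Zᵇ : ∀ v → 1ℤ - Zᵇ v ≡ 0ℤ ⊎ Any (λ a → ¬ + 2 ∣ a) (∇Δ 0ℤ v)
    smooth-off-Zᵇ (a ∷ b ∷ c ∷ a′ ∷ b′ ∷ c′ ∷ []) with + 2 ∣? b | + 2 ∣? c | + 2 ∣? b′ | + 2 ∣? c′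
    ... | no ¬d | _     | _     | _     = inj₂ (there (there (here λ d → ¬d (subst (+ 2 ∣_) (neg-involutive b) (∣m⇒∣-m d)))))
    ... | _     | no ¬d | _     | _     = inj₂ (there (here λ d → ¬d (subst (+ 2 ∣_) (neg-involutive c) (∣m⇒∣-m d))))
    ... | _     | _     | no ¬d | _     = inj₂ (there (there (there (there (there (here ¬d))))))
    ... | _     | _     | _     | no ¬d = inj₂ (there (there (there (there (here ¬d)))))
    ... | yes p | yes r | yes p′ | yes r′ = inj₁ (cong (λ u → 1ℤ - u)
      (cong₂ _*_ (δ-1 p) (cong₂ _*_ (δ-1 r) (cong₂ _*_ (δ-1 p′) (δ-1 r′)))))

    -- For odd a = 2x + 1 one has a (- a) = 4 x (- 1 - x) - 1, so the trace becomes - 1.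
    Δ-odd-scale : ∀ h → Δ 0ℤ (1ᵛ ⊕ + 2 · h) ≡ + 4 * Δ -1ℤ h
    Δ-odd-scale (a ∷ b ∷ c ∷ a′ ∷ b′ ∷ c′ ∷ []) = arith a b c a′ b′ c′
      where
      arith : ∀ a b c a′ b′ c′ →
        (1ℤ + + 2 * a) * (0ℤ - (1ℤ + + 2 * a)) - (0ℤ + + 2 * b) * (0ℤ + + 2 * c)
          - ((1ℤ + + 2 * a′) * (0ℤ - (1ℤ + + 2 * a′)) - (0ℤ + + 2 * b′) * (0ℤ + + 2 * c′)) ≡
        + 4 * (a * (-1ℤ - a) - b * c - (a′ * (-1ℤ - a′) - b′ * c′))
      arith = solve-∀

    -- After division by 4 the trace is -1, so every point is smooth and lifts from modulus 2, where
    -- there are 40. The exponent `3 + j` ensures that the remaining modulus `K` is at least 2; the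
    -- factor 64 is one surplus digit in six coordinates.
    ∑ᵛ-odd : ∀ {W} → Periodicᵛ 2 W → ∀ j → let N = 2 ℕ.^ (3 ℕ.+ j) in
      ∑ᵛ N (λ v → δᵛ 2 1ᵛ v * (W v * δ N (Δ 0ℤ v))) ≡ W 1ᵛ * (+ 64 * ((+ 32) ^ j * + 40))
    ∑ᵛ-odd {W} W-periodic j = begin
      ∑ᵛ (2 ℕ.* (2 ℕ.* K)) (λ v → δᵛ 2 1ᵛ v * (W v * δ N (Δ 0ℤ v)))
        ≡⟨ cong (λ K → ∑ᵛ K (λ v → δᵛ 2 1ᵛ v * (W v * δ N (Δ 0ℤ v)))) (ℕ.*-comm 2 (2 ℕ.* K)) ⟩
      ∑ᵛ (2 ℕ.* K ℕ.* 2) (λ v → δᵛ 2 1ᵛ v * (W v * δ N (Δ 0ℤ v)))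
        ≡⟨ ∑ᵛ-residues (2 ℕ.* K) 2 (1 ∷ 0 ∷ 0 ∷ 1 ∷ 0 ∷ 0 ∷ [])
             (1<2 ∷ 0<2 ∷ 0<2 ∷ 1<2 ∷ 0<2 ∷ 0<2 ∷ []) (λ v → W v * δ N (Δ 0ℤ v)) ⟩
      ∑ᵛ (2 ℕ.* K) (λ h → W (1ᵛ ⊕ + 2 · h) * δ N (Δ 0ℤ (1ᵛ ⊕ + 2 · h)))
        ≡⟨ ∑ᵛ-cong (2 ℕ.* K) (λ h → cong₂ _*_ (W-periodic 1ᵛ h) (rescale h)) ⟩
      ∑ᵛ (2 ℕ.* K) (λ h → W 1ᵛ * δ K (Δ -1ℤ h))
        ≡⟨ ∑ᵛ-*ˡ (2 ℕ.* K) (W 1ᵛ) (λ h → δ K (Δ -1ℤ h)) ⟩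
      W 1ᵛ * ∑ᵛ (2 ℕ.* K) (λ h → δ K (Δ -1ℤ h))
        ≡⟨ cong (W 1ᵛ *_) (∑ᵛ-periodic 2 K (Δ-periodic K -1ℤ)) ⟩
      W 1ᵛ * (+ 64 * ∑ᵛ K (λ h → δ K (Δ -1ℤ h)))
        ≡⟨ cong (λ u → W 1ᵛ * (+ 64 * u)) (trans
             (∑ᵛ-cong K λ h → sym (*-identityˡ (δ K (Δ -1ℤ h))))
             (trans (Hensel.hensel {f = Δ -1ℤ} {w = λ _ → 1ℤ} (taylor -1ℤ) (λ _ _ → refl)
                 (λ x → inj₂ (∇Δ-odd -1ℤ -1ℤ refl x)) j)
               (cong ((+ 32) ^ j *_) minus-one-count))) ⟩
      W 1ᵛ * (+ 64 * ((+ 32) ^ j * + 40))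
        ∎
      where
      open ≡-Reasoning
      K = 2 ℕ.^ suc j
      N = 2 ℕ.^ (3 ℕ.+ j)
      0<2 : 0 ℕ.< 2
      0<2 = ℕ.z<s
      1<2 : 1 ℕ.< 2
      1<2 = ℕ.s<s ℕ.z<s
      rescale : ∀ h → δ N (Δ 0ℤ (1ᵛ ⊕ + 2 · h)) ≡ δ K (Δ -1ℤ h)
      rescale h = trans (cong₂ δ (sym (ℕ.*-assoc 2 2 K)) (Δ-odd-scale h)) (δ-scale 4 K (Δ -1ℤ h))

    pairs-step₂ : ∀ {W} → Periodicᵛ 2 W → ∀ j →
      pairs W (2 ℕ.^ (3 ℕ.+ j)) ≡
        (+ 32) ^ (2 ℕ.+ j) * pairs (λ v → W v * (1ℤ - Zᵇ v)) 2
        + (W 0ᵛ * (+ 64 * T (suc j)) + W 1ᵛ * (+ 64 * ((+ 32) ^ j * + 40)))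
    pairs-step₂ {W} W-periodic j = begin
      pairs W N
        ≡⟨ ∑ᵛ-cong N (parity-split W (ℕ.m∣m*n (2 ℕ.^ (2 ℕ.+ j)))) ⟩
      ∑ᵛ N (λ v → w v * d v + (δᵛ 2 0ᵛ v * (W v * d v) + δᵛ 2 1ᵛ v * (W v * d v)))
        ≡⟨ ∑ᵛ-+ N (λ v → w v * d v) (λ v → δᵛ 2 0ᵛ v * (W v * d v) + δᵛ 2 1ᵛ v * (W v * d v)) ⟩
      pairs w N + ∑ᵛ N (λ v → δᵛ 2 0ᵛ v * (W v * d v) + δᵛ 2 1ᵛ v * (W v * d v))
        ≡⟨ cong₂ _+_ (Hensel.hensel {f = Δ 0ℤ} (taylor 0ℤ) w-periodic smooth (2 ℕ.+ j))
             (trans (∑ᵛ-+ N (λ v → δᵛ 2 0ᵛ v * (W v * d v)) (λ v → δᵛ 2 1ᵛ v * (W v * d v)))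
               (cong₂ _+_ (∑ᵛ-singular W-periodic (suc j)) (∑ᵛ-odd W-periodic j))) ⟩
      (+ 32) ^ (2 ℕ.+ j) * pairs w 2 + (W 0ᵛ * (+ 64 * T (suc j)) + W 1ᵛ * (+ 64 * ((+ 32) ^ j * + 40)))
        ∎
      where
      open ≡-Reasoning
      N = 2 ℕ.^ (3 ℕ.+ j)
      d w : Vec ℤ 6 → ℤ
      d v = δ N (Δ 0ℤ v)
      w v = W v * (1ℤ - Zᵇ v)
      w-periodic : Periodicᵛ 2 w
      w-periodic x h = cong₂ _*_ (W-periodic x h) (cong (λ u → 1ℤ - u) (Zᵇ-periodic x h))
      smooth : ∀ v → w v ≡ 0ℤ ⊎ Any (λ a → ¬ + 2 ∣ a) (∇Δ 0ℤ v)
      smooth v with smooth-off-Zᵇ v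
      ... | inj₁ eq  = inj₁ (trans (cong (W v *_) eq) (*-zeroʳ (W v)))
      ... | inj₂ any = inj₂ any

    opaque
      unfolding δ
      -- Of the 32 zeros modulo 2, the two singular ones `0ᵛ` and `1ᵛ` are removed. In the two
      -- counts below, the unit condition keeps 16 zeros, one of them singular.
      smooth-count : pairs (λ v → 1ℤ * (1ℤ - Zᵇ v)) 2 ≡ + 30
      smooth-count = refl

      smooth-count-0 : pairs (λ v → unit-at 0ℤ v * (1ℤ - Zᵇ v)) 2 ≡ + 15
      smooth-count-0 = refl

      smooth-count-1 : pairs (λ v → unit-at 1ℤ v * (1ℤ - Zᵇ v)) 2 ≡ + 15
      smooth-count-1 = refl

      -- The source of the distinction between 4 dividing `t` and not: for even `s` only the odd
      -- class survives, for odd `s` only the class of the origin.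
      unit-at-values : unit-at 0ℤ 0ᵛ ≡ 0ℤ × unit-at 0ℤ 1ᵛ ≡ 1ℤ × unit-at 1ℤ 0ᵛ ≡ 1ℤ × unit-at 1ℤ 1ᵛ ≡ 0ℤ
      unit-at-values = refl , refl , refl , refl

      T₁≡ : T 1 ≡ + 32
      T₁≡ = refl

      T₂≡ : T 2 ≡ + 1088
      T₂≡ = refl

    T-step : ∀ j → T (3 ℕ.+ j) ≡
      (+ 32) ^ (2 ℕ.+ j) * + 30 + (+ 64 * T (suc j) + + 64 * ((+ 32) ^ j * + 40))
    T-step j = trans
      (∑ᵛ-cong (2 ℕ.^ (3 ℕ.+ j)) λ v → sym (*-identityˡ (δ (2 ℕ.^ (3 ℕ.+ j)) (Δ 0ℤ v))))
      (trans (pairs-step₂ {λ _ → 1ℤ} (λ _ _ → refl) j) (cong₂ _+_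
        (cong ((+ 32) ^ (2 ℕ.+ j) *_) smooth-count)
        (cong₂ _+_ (*-identityˡ (+ 64 * T (suc j))) (*-identityˡ (+ 64 * ((+ 32) ^ j * + 40))))))

    -- As for odd primes, 8 is the homogeneous root, since 64 is its square. The formula starts at
    -- index 1: `T 0` is 1 and would not fit.
    T-closed : ∀ j → T (suc j) * + 12 ≡ (+ 32) ^ suc j * + 13 - (+ 8) ^ suc j * + 4
    T-closed 0             = cong (_* + 12) T₁≡
    T-closed 1             = cong (_* + 12) T₂≡
    T-closed (suc (suc j)) = trans (cong (_* + 12) (T-step j))
      (trans (distribute ((+ 32) ^ j) (T (suc j))) (trans
        -- The constant is 12 · (32² · 30 + 64 · 40), the smooth and the odd contribution together.
        (cong (λ u → (+ 32) ^ j * + 399360 + u * + 64) (T-closed j))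
        (arith ((+ 32) ^ j) ((+ 8) ^ j))))
      where
      distribute : ∀ x u → (+ 32 * (+ 32 * x) * + 30 + (+ 64 * u + + 64 * (x * + 40))) * + 12 ≡ x * + 399360 + u * + 12 * + 64
      distribute = solve-∀
      arith : ∀ x y → x * + 399360 + (+ 32 * x * + 13 - + 8 * y * + 4) * + 64 ≡
        + 32 * (+ 32 * (+ 32 * x)) * + 13 - + 8 * (+ 8 * (+ 8 * y)) * + 4
      arith = solve-∀

    -- Only the parity of half the trace affects the weight, so two values of `s` cover all even
    -- traces.
    unit-at-mod-2 : ∀ s y v → unit-at (s + + 2 * y) v ≡ unit-at s v
    unit-at-mod-2 s y v = trans (cong (unit prime[2]) (arith s y (q 0ℤ (left v))))
      (unit-periodic prime[2] (s * s + q 0ℤ (left v)) (+ 2 * (s * y + y * y)))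
      where
      arith : ∀ s y x → (s + + 2 * y) * (s + + 2 * y) + x ≡ (s * s + x) + + 2 * (+ 2 * (s * y + y * y))
      arith = solve-∀

    S-even : ∀ s y j → + S (+ 2 * (s + + 2 * y)) (2 ℕ.^ (3 ℕ.+ j)) ≡ pairs (unit-at s) (2 ℕ.^ (3 ℕ.+ j))
    S-even s y j = trans
      (S-pairs (+ 2 * (s + + 2 * y)) (s + + 2 * y) 0ℤ (2 ℕ.+ j) (arith (s + + 2 * y) (+ (2 ℕ.^ (3 ℕ.+ j)))))
      (∑ᵛ-cong N λ v → cong (_* δ N (Δ 0ℤ v)) (unit-at-mod-2 s y v))
      where
      N = 2 ℕ.^ (3 ℕ.+ j)
      arith : ∀ s N → + 2 * s ≡ + 2 * s + N * 0ℤ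
      arith = solve-∀

    S-4∣t : ∀ y j → + S (+ 2 * (0ℤ + + 2 * y)) (2 ℕ.^ (3 ℕ.+ j)) ≡ (+ 32) ^ (2 ℕ.+ j) * + 15 + (+ 32) ^ j * + 2560
    S-4∣t y j with e₀ , e₁ , _ ← unit-at-values = trans (S-even 0ℤ y j) (trans (pairs-step₂ (unit-at-periodic 0ℤ) j) (cong₂ _+_
      (cong ((+ 32) ^ (2 ℕ.+ j) *_) smooth-count-0)
      (trans (cong₂ (λ a b → a * (+ 64 * T (suc j)) + b * (+ 64 * ((+ 32) ^ j * + 40))) e₀ e₁)
        (arith ((+ 32) ^ j) (T (suc j))))))
      where
      arith : ∀ x u → 0ℤ * (+ 64 * u) + 1ℤ * (+ 64 * (x * + 40)) ≡ x * + 2560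
      arith = solve-∀

    S-2∥t : ∀ y j → + S (+ 2 * (1ℤ + + 2 * y)) (2 ℕ.^ (3 ℕ.+ j)) ≡ (+ 32) ^ (2 ℕ.+ j) * + 15 + T (suc j) * + 64
    S-2∥t y j with _ , _ , e₀ , e₁ ← unit-at-values = trans (S-even 1ℤ y j) (trans (pairs-step₂ (unit-at-periodic 1ℤ) j) (cong₂ _+_
      (cong ((+ 32) ^ (2 ℕ.+ j) *_) smooth-count-1)
      (trans (cong₂ (λ a b → a * (+ 64 * T (suc j)) + b * (+ 64 * ((+ 32) ^ j * + 40))) e₀ e₁)
        (arith ((+ 32) ^ j) (T (suc j))))))
      where
      arith : ∀ x u → 1ℤ * (+ 64 * u) + 0ℤ * (+ 64 * (x * + 40)) ≡ u * + 64
      arith = solve-∀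

    normalised-S-odd : ∀ t y j → t ≡ 1ℤ + + 2 * y → let k = suc j in
      (+ S t (2 ℕ.^ k)) /ℕ (2 ℕ.^ (5 ℕ.* k ℕ.∸ 5)) ≡ (+ 4) /ℕ 1
    normalised-S-odd t y j t≡ = /ℕ-≡ (+ S t (2 ℕ.^ k)) (+ 4) (2 ℕ.^ (5 ℕ.* k ℕ.∸ 5)) 1 {{ℕ.m^n≢0 2 (5 ℕ.* k ℕ.∸ 5)}}
      (trans (*-identityʳ (+ S t (2 ℕ.^ k))) (trans (S-odd t y j t≡) (trans (*-comm ((+ 32) ^ j) (+ 4))
        (cong (+ 4 *_) (sym (denominator 2 j))))))
      where k = suc j

    normalised-S-4∣t : ∀ t y j → t ≡ + 2 * (0ℤ + + 2 * y) → let k = 3 ℕ.+ j in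
      (+ S t (2 ℕ.^ k)) /ℕ (2 ℕ.^ (5 ℕ.* k ℕ.∸ 5)) ≡ (+ 35) /ℕ 2
    normalised-S-4∣t t y j refl = /ℕ-≡ (+ S t (2 ℕ.^ k)) (+ 35) (2 ℕ.^ (5 ℕ.* k ℕ.∸ 5)) 2 {{ℕ.m^n≢0 2 (5 ℕ.* k ℕ.∸ 5)}}
      (trans (cong (_* + 2) (S-4∣t y j)) (trans (arith ((+ 32) ^ j)) (cong (+ 35 *_) (sym (denominator 2 (2 ℕ.+ j))))))
      where
      k = 3 ℕ.+ j
      arith : ∀ x → (+ 32 * (+ 32 * x) * + 15 + x * + 2560) * + 2 ≡ + 35 * (+ 32 * (+ 32 * x))
      arith = solve-∀

    normalised-S-2∥t : ∀ t y j → t ≡ + 2 * (1ℤ + + 2 * y) → let k = 3 ℕ.+ j in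
      (+ S t (2 ℕ.^ k)) /ℕ (2 ℕ.^ (5 ℕ.* k ℕ.∸ 5)) ≡ (+ 103) /ℕ 6 ℚ.- (+ 32) /ℕ (3 ℕ.* 2 ℕ.^ (2 ℕ.* k))
    normalised-S-2∥t t y j refl = trans
      (/ℕ-≡ (+ S t (2 ℕ.^ k)) (+ 103 * + (3 ℕ.* Q) - + 32 * + 6) (2 ℕ.^ (5 ℕ.* k ℕ.∸ 5)) (6 ℕ.* (3 ℕ.* Q)) cross)
      (sym (/ℕ-− (+ 103) (+ 32) 6 (3 ℕ.* Q)))
      where
      k = 3 ℕ.+ j
      Q = 2 ℕ.^ (2 ℕ.* k)
      instance
        Q≢0 : NonZero Q
        Q≢0 = ℕ.m^n≢0 2 (2 ℕ.* k)
        3Q≢0 : NonZero (3 ℕ.* Q)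
        3Q≢0 = ℕ.m*n≢0 3 Q
        18Q≢0 : NonZero (6 ℕ.* (3 ℕ.* Q))
        18Q≢0 = ℕ.m*n≢0 6 (3 ℕ.* Q)
        D≢0 : NonZero (2 ℕ.^ (5 ℕ.* k ℕ.∸ 5))
        D≢0 = ℕ.m^n≢0 2 (5 ℕ.* k ℕ.∸ 5)
      X w z : ℤ
      X = (+ 32) ^ suc j
      w = (+ 8) ^ suc j
      z = (+ 4) ^ suc j
      U = T (suc j)
      +Q : + Q ≡ z * + 16
      +Q = trans (ℓ^[2k] 2 k) (trans (sym (*-assoc (+ 4) (+ 4) z)) (*-comm (+ 16) z))
      +18Q : + (6 ℕ.* (3 ℕ.* Q)) ≡ + 6 * (+ 3 * (z * + 16))
      +18Q = trans (pos-* 6 (3 ℕ.* Q)) (cong (+ 6 *_) (trans (pos-* 3 Q) (cong (+ 3 *_) +Q)))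
      -- The common denominator is 288 `z`; 138240 is 32 · 15 · 288, and 1536 is 64 · 288 / 12, with
      -- the 12 kept beside `U` for `T-closed`.
      distribute : ∀ X U z → (+ 32 * X * + 15 + U * + 64) * (+ 6 * (+ 3 * (z * + 16))) ≡ X * z * + 138240 + U * + 12 * (z * + 1536)
      distribute = solve-∀
      final : ∀ w z → w * z * z * + 138240 + (w * z * + 13 - w * + 4) * (z * + 1536) ≡
        (+ 103 * (+ 3 * (z * + 16)) - + 32 * + 6) * (+ 32 * (w * z))
      final = solve-∀
      cross : + S t (2 ℕ.^ k) * + (6 ℕ.* (3 ℕ.* Q)) ≡ (+ 103 * + (3 ℕ.* Q) - + 32 * + 6) * + (2 ℕ.^ (5 ℕ.* k ℕ.∸ 5))
      cross = begin
        + S t (2 ℕ.^ k) * + (6 ℕ.* (3 ℕ.* Q))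
          ≡⟨ cong₂ _*_ (S-2∥t y j) +18Q ⟩
        (+ 32 * X * + 15 + U * + 64) * (+ 6 * (+ 3 * (z * + 16)))
          ≡⟨ distribute X U z ⟩
        X * z * + 138240 + U * + 12 * (z * + 1536)
          ≡⟨ cong (λ u → X * z * + 138240 + u * (z * + 1536)) (T-closed j) ⟩
        X * z * + 138240 + (X * + 13 - w * + 4) * (z * + 1536)
          ≡⟨ cong (λ X → X * z * + 138240 + (X * + 13 - w * + 4) * (z * + 1536)) (^-*-distrib (+ 8) (+ 4) (suc j)) ⟩
        w * z * z * + 138240 + (w * z * + 13 - w * + 4) * (z * + 1536)
          ≡⟨ final w z ⟩
        (+ 103 * (+ 3 * (z * + 16)) - + 32 * + 6) * (+ 32 * (w * z))
          ≡⟨ sym (cong₂ _*_ (cong (λ u → + 103 * u - + 32 * + 6) (trans (pos-* 3 Q) (cong (+ 3 *_) +Q)))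
               (trans (denominator 2 (2 ℕ.+ j)) (cong (+ 32 *_) (^-*-distrib (+ 8) (+ 4) (suc j))))) ⟩
        (+ 103 * + (3 ℕ.* Q) - + 32 * + 6) * + (2 ℕ.^ (5 ℕ.* k ℕ.∸ 5))
          ∎
        where open ≡-Reasoning

    case-odd : ∀ t j → ¬ + 2 ∣ t → let k = 3 ℕ.+ j in
      (+ S t (2 ℕ.^ k)) /ℕ (2 ℕ.^ (5 ℕ.* k ℕ.∸ 5)) ≡ (+ 4) /ℕ 1
    case-odd t j 2∤t with parity t
    ... | inj₁ (h , refl) = contradiction (∣m⇒∣m*n h ∣-refl) 2∤t
    ... | inj₂ (y , t≡)   = normalised-S-odd t y (2 ℕ.+ j) t≡

    case-4∣t : ∀ t j → + 4 ∣ t → let k = 3 ℕ.+ j in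
      (+ S t (2 ℕ.^ k)) /ℕ (2 ℕ.^ (5 ℕ.* k ℕ.∸ 5)) ≡ (+ 35) /ℕ 2
    case-4∣t t j (divides y eq) = normalised-S-4∣t t y j (trans eq (arith y))
      where
      arith : ∀ y → y * + 4 ≡ + 2 * (0ℤ + + 2 * y)
      arith = solve-∀

    case-2∥t : ∀ t j → + 2 ∣ t → ¬ + 4 ∣ t → let k = 3 ℕ.+ j in
      (+ S t (2 ℕ.^ k)) /ℕ (2 ℕ.^ (5 ℕ.* k ℕ.∸ 5)) ≡ (+ 103) /ℕ 6 ℚ.- (+ 32) /ℕ (3 ℕ.* 2 ℕ.^ (2 ℕ.* k))
    case-2∥t t j (divides h eq) 4∤t with parity h
    ... | inj₁ (y , refl) = contradiction (divides y (trans eq (arith y))) 4∤t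
      where
      arith : ∀ y → + 2 * y * + 2 ≡ y * + 4
      arith = solve-∀
    ... | inj₂ (y , refl) = normalised-S-2∥t t y j (trans eq (*-comm (1ℤ + + 2 * y) (+ 2)))

-- Assembling the five cases

open import Defs
open import Data.Nat as ℕ using (ℕ; _≥_; _>_; _^_; _∸_)
open import Data.Nat.Primality using (Prime)
open import Data.Integer as ℤ using (ℤ; +_)
open import Data.Integer.Divisibility using (_∣_)
open import Data.Rational as ℚ using (ℚ)
open import Data.Product using (_×_)
open import Relation.Nullary using (¬_)
open import Relation.Binary.PropositionalEquality using (_≡_)
open import Data.Nat using (suc; s≤s; z≤n)
open import Data.Nat.Divisibility using (>⇒∤)
open import Data.Integer.Divisibility.Signed using (∣ᵤ⇒∣; ∣⇒∣ᵤ; ∣m⇒∣m*n; ∣n⇒∣m*n)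
open import Data.Product using (_,_)
open import Function using (_∘_)
open import Relation.Binary.PropositionalEquality using (refl)
open Counting

theorem1p4 : (ℓ : ℕ) → Prime ℓ → (t : ℤ) → (k : ℕ) → k ≥ 3 →
  let L = + ℓ
      lhs = (+ (S t (ℓ ^ k))) /ℕ (ℓ ^ (5 ℕ.* k ∸ 5))
  in ((+ ℓ ∣ t) → ℓ > 2 →
        lhs ≡ (L ℤ.* L ℤ.* (L ℤ.* L ℤ.+ + 1) ℤ.* (L ℤ.- + 1)) /ℕ 1)
   × (¬ (+ ℓ ∣ (+ 2 ℤ.* t)) →
        lhs ≡ ((L ℤ.* L ℤ.* (L ℤ.* L ℤ.* L ℤ.* L ℤ.- + 2 ℤ.* L ℤ.* L ℤ.- + 3 ℤ.* L ℤ.- + 1)) /ℕ (ℓ ℕ.+ 1))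
              ℚ.- ((L ℤ.* L ℤ.* L ℤ.* L) /ℕ ((ℓ ^ (2 ℕ.* k)) ℕ.* (ℓ ℕ.+ 1))))
   × (ℓ ≡ 2 → ¬ (+ 2 ∣ t) → lhs ≡ (+ 4) /ℕ 1)
   × (ℓ ≡ 2 → (+ 4 ∣ t) → lhs ≡ (+ 35) /ℕ 2)
   × (ℓ ≡ 2 → (+ 2 ∣ t) → ¬ (+ 4 ∣ t) →
        lhs ≡ ((+ 103) /ℕ 6) ℚ.- ((+ 32) /ℕ (3 ℕ.* (2 ^ (2 ℕ.* k)))))
theorem1p4 ℓ ℓ-prime t (suc (suc (suc j))) (s≤s (s≤s (s≤s z≤n))) =
    -- The lemmas for odd primes write the exponent as `2 + j`, hence the argument `suc j`.
    (λ ℓ∣t ℓ>2 → OddCase.normalised-S-ℓ∣t ℓ-prime (>⇒∤ ℓ>2 ∘ ∣⇒∣ᵤ) t (suc j) (∣ᵤ⇒∣ ℓ∣t))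
  -- That ℓ does not divide `2 t` yields both that ℓ is odd and that it does not divide `t`.
  , (λ ℓ∤2t → OddCase.normalised-S-ℓ∤t ℓ-prime (ℓ∤2t ∘ ∣⇒∣ᵤ ∘ ∣m⇒∣m*n t) t (suc j) (ℓ∤2t ∘ ∣⇒∣ᵤ ∘ ∣n⇒∣m*n (+ 2)))
  , (λ { refl 2∤t → TwoAdic.case-odd t j (2∤t ∘ ∣⇒∣ᵤ) })
  , (λ { refl 4∣t → TwoAdic.case-4∣t t j (∣ᵤ⇒∣ 4∣t) })
  , (λ { refl 2∣t 4∤t → TwoAdic.case-2∥t t j (∣ᵤ⇒∣ 2∣t) (4∤t ∘ ∣⇒∣ᵤ) })
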